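{- Let $n\in\mathbb{N}$ and let $\sigma$ be a probability distribution on $[n]$ such that $\sigma_{\le i}>\tfrac in$ for every $i\in[n-1]$. Then the transition probabilities $P$ on $\mathbb{N}_0^{n-1}$ (defined in the context) admit the stationary distribution \[\pi=\bigotimes_{i=1}^{n-1}\mathrm{Geom}\Big(1-\frac{i}{n\,\sigma_{\le i}}\Big).\]
   Context: For a probability distribution $\sigma$ on $[n]$ write $\sigma_i=\Pr_{i^*\sim\sigma}[i^*=i]$ and $\sigma_{\le i}=\Pr_{i^*\sim\sigma}[i^*\le i]$. $\mathrm{Geom}(p)$ is the distribution of the number of failed independent Bernoulli($p$) trials before the first success (support $\mathbb{N}_0$), and $\bigotimes$ is the product of independent distributions. States are vectors $\vec d=(d_1,\dots,d_{n-1})\in\mathbb{N}_0^{n-1}$ (interpretation: $d_i$ is the number of elements strictly between the $i$-th and $(i+1)$-th smallest top-element of a MultiQueue with $n$ queues). Let $\vec e_i$ be the $i$-th unit vector for $i\in[n-1]$, and set the conventions $d_n=\infty$ and $\vec e_n=\vec 0$. The transition from a state $\vec d_{\mathrm{start}}$ to a state $\vec d_{\mathrm{end}}$ proceeds through transitional states $(\vec d,i)\in\mathbb{N}_0^{n-1}\times[n]$: (1) sample $i^*\sim\sigma$ and go to the transitional state $(\vec d_{\mathrm{start}},i^*)$. (2) While in a transitional state $(\vec d,i)$: if $d_i>0$, then with probability $(i-1)/i$ move to the transitional state $(\vec d-\vec e_i+\vec e_{i-1},i)$, and with probability $1/i$ end the transition in the state $\vec d_{\mathrm{end}}=\vec d-\vec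 e_i$; if $d_i=0$, move to the transitional state $(\vec d,i+1)$. $P(\vec d_{\mathrm{start}},\vec d_{\mathrm{end}})$ is the resulting probability of ending in $\vec d_{\mathrm{end}}$. A distribution $\pi$ is stationary if $\vec d_{\mathrm{start}}\sim\pi$ implies $\vec d_{\mathrm{end}}\sim\pi$. -}

module Defs where

open import Algebra.Bundles using (CommutativeRing)
open import Algebra.Structures using (IsCommutativeRing)
import Algebra.Definitions.RawMonoid as RawMonoidDefs
open import Data.Bool.Base using (if_then_else_)
open import Data.Fin.Base using (Fin; zero; suc; toℕ; inject₁)
import Data.Fin.Properties as Fin
open import Data.Fin.Relation.Unary.Top using (view; ‵fromℕ; ‵inject₁)
open import Data.Integer.Base as ℤ using (+_; -[1+_])
import Data.Integer.Properties as ℤ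
open import Data.List.Base as List using (List)
open import Data.List.Relation.Binary.Subset.Propositional using (_⊆_)
open import Data.List.Relation.Unary.Unique.Propositional using (Unique)
open import Data.Nat.Base as ℕ using (ℕ; zero; suc)
import Data.Nat.Properties as ℕ
open import Data.Product.Base using (∃-syntax; _×_; _,_; proj₁; proj₂)
open import Data.Rational.Base as ℚ using (ℚ; 0ℚ; 1ℚ; ½; ∣_∣; toℚᵘ; mkℚ)
import Data.Rational.Properties as ℚ
open import Data.Rational.Solver using (module +-*-Solver)
import Data.Rational.Unnormalised.Base as ℚᵘ
import Data.Rational.Unnormalised.Properties as ℚᵘ
open import Data.Sum.Base using (_⊎_; inj₁; inj₂)
open import Data.Vec.Base using (Vec; lookup; updateAt; _[_]≔_)
import Data.Vec.Properties as Vec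
open import Level using (0ℓ; _⊔_) renaming (suc to lsuc)
open import Relation.Binary.Core using (Rel)
open import Relation.Binary.Structures using (IsStrictPartialOrder; IsEquivalence)
import Relation.Binary.Reasoning.Setoid as ≈-Reasoning
open import Relation.Binary.PropositionalEquality.Core using (_≡_; refl; sym; trans; cong; cong₂; subst; subst₂)
open import Relation.Binary.PropositionalEquality.Properties using (module ≡-Reasoning)
open import Relation.Nullary.Decidable.Core using (does; yes; no; toWitness)
open import Relation.Nullary.Negation.Core using (¬_; contradiction)

-- Ordered fields in constructive form: _<_ is not assumed decidable, and
-- x ≤ y is the negation of y < x.  The real numbers are the instance ℝ-field.
record ArchimedeanOrderedField c ℓ₁ ℓ₂ : Set (lsuc (c ⊔ ℓ₁ ⊔ ℓ₂)) where
  field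
    commutativeRing : CommutativeRing c ℓ₁

  open CommutativeRing commutativeRing public

  open RawMonoidDefs +-rawMonoid using () renaming (_×_ to _×#_)

  fromℕ : ℕ → Carrier
  fromℕ n = n ×# 1#

  infix 4 _<_ _≤_

  field
    _<_                    : Rel Carrier ℓ₂
    <-isStrictPartialOrder : IsStrictPartialOrder _≈_ _<_
    <-cotrans              : ∀ {x y} → x < y → ∀ z → x < z ⊎ z < y
    <-tight                : ∀ {x y} → ¬ x < y → ¬ y < x → x ≈ y
    +-monoʳ-<              : ∀ z {x y} → x < y → z + x < z + y
    *-pos                  : ∀ {x y} → 0# < x → 0# < y → 0# < x * y
    0<1                    : 0# < 1#
    recip                  : ∀ x → 0# < x → Carrier
    *-recip                : ∀ x (0<x : 0# < x) → x * recip x 0<x ≈ 1#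
    archimedean            : ∀ x → ∃[ n ] x < fromℕ n

  _≤_ : Rel Carrier ℓ₂
  x ≤ y = ¬ y < x

Eventually : (ℕ → Set) → Set
Eventually P = ∃[ N ] ∀ n → N ℕ.≤ n → P n

-- Real numbers as Cauchy sequences of rationals, up to _≈ℝ_.
record ℝ : Set where
  constructor mkℝ
  field
    seq    : ℕ → ℚ
    cauchy : ∀ ε → 0ℚ ℚ.< ε →
             ∃[ N ] ∀ m n → N ℕ.≤ m → N ℕ.≤ n → ∣ seq m ℚ.- seq n ∣ ℚ.< ε

open ℝ

infix 4 _≈ℝ_ _<ℝ_

_≈ℝ_ : Rel ℝ 0ℓ
x ≈ℝ y = ∀ ε → 0ℚ ℚ.< ε → Eventually λ n → ∣ seq x n ℚ.- seq y n ∣ ℚ.< ε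

_<ℝ_ : Rel ℝ 0ℓ
x <ℝ y = ∃[ ε ] 0ℚ ℚ.< ε × Eventually λ n → seq x n ℚ.+ ε ℚ.< seq y n

open +-*-Solver using (solve; _:+_; _:*_; _:-_; :-_; _:=_; con)

abstract
 private

  r1 : ∀ p q → q ℚ.- p ℚ.+ p ≡ q
  r1 = solve 2 (λ p q → q :- p :+ p := q) refl

  r2 : ∀ p e → e ℚ.- (ℚ.- p) ≡ e ℚ.+ p
  r2 = solve 2 (λ p e → e :- (:- p) := e :+ p) refl

  r3 : ∀ p q → ℚ.- (p ℚ.- q) ≡ q ℚ.- p
  r3 = solve 2 (λ p q → :- (p :- q) := q :- p) refl

  r4 : ∀ B e i → B ℚ.* (e ℚ.* i) ≡ e ℚ.* (B ℚ.* i)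
  r4 = solve 3 (λ B e i → B :* (e :* i) := e :* (B :* i)) refl

  r5 : ∀ a → 1ℚ ℚ.+ (a ℚ.+ 1ℚ) ≡ a ℚ.+ 1ℚ ℚ.+ 1ℚ
  r5 = solve 1 (λ a → con 1ℚ :+ (a :+ con 1ℚ) := a :+ con 1ℚ :+ con 1ℚ) refl

  r6 : ∀ a b c d → a ℚ.* (b ℚ.- d) ℚ.+ d ℚ.* (a ℚ.- c) ≡ a ℚ.* b ℚ.- c ℚ.* d
  r6 = solve 4 (λ a b c d → a :* (b :- d) :+ d :* (a :- c) := a :* b :- c :* d) refl

  r7 : ∀ a b c d → (a ℚ.- b) ℚ.+ (c ℚ.- d) ≡ (a ℚ.+ c) ℚ.- (b ℚ.+ d)
  r7 = solve 4 (λ a b c d → (a :- b) :+ (c :- d) := (a :+ c) :- (b :+ d)) refl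

  r8 : ∀ a b → b ℚ.- a ≡ (ℚ.- a) ℚ.- (ℚ.- b)
  r8 = solve 2 (λ a b → b :- a := (:- a) :- (:- b)) refl

  r9 : ∀ a b → ℚ.- (a ℚ.- b) ≡ 1ℚ ℚ.* b ℚ.- 1ℚ ℚ.* a
  r9 = solve 2 (λ a b → :- (a :- b) := con 1ℚ :* b :- con 1ℚ :* a) refl

  r10 : ∀ a b i j → (a ℚ.* i) ℚ.* b ℚ.- (b ℚ.* j) ℚ.* a ≡ (a ℚ.* b) ℚ.* (i ℚ.- j)
  r10 = solve 4 (λ a b i j → a :* i :* b :- b :* j :* a := a :* b :* (i :- j)) refl

  halves : ∀ ε → ½ ℚ.* ε ℚ.+ ½ ℚ.* ε ≡ ε
  halves = solve 1 (λ e → con ½ :* e :+ con ½ :* e := e) refl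

  both : ∀ {P Q : ℕ → Set} → Eventually P → Eventually Q → Eventually λ n → P n × Q n
  both (M , p) (N , q) = M ℕ.⊔ N , λ n le →
    p n (ℕ.≤-trans (ℕ.m≤m⊔n M N) le) , q n (ℕ.≤-trans (ℕ.m≤n⊔m M N) le)

  evMap : ∀ {P Q : ℕ → Set} → (∀ n → P n → Q n) → Eventually P → Eventually Q
  evMap f (N , p) = N , λ n le → f n (p n le)

  diff : ∀ {p q} → p ℚ.< q → 0ℚ ℚ.< q ℚ.- p
  diff {p} {q} p<q = subst (ℚ._< q ℚ.- p) (ℚ.+-inverseʳ p) (ℚ.+-monoˡ-< (ℚ.- p) p<q)

  undiff : ∀ {p q} → 0ℚ ℚ.< q ℚ.- p → p ℚ.< q
  undiff {p} {q} h = subst₂ ℚ._<_ (ℚ.+-identityˡ p)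
    (r1 p q) (ℚ.+-monoˡ-< p h)

  pos+ : ∀ {p q} → 0ℚ ℚ.< p → 0ℚ ℚ.< q → 0ℚ ℚ.< p ℚ.+ q
  pos+ = ℚ.+-mono-<

  pos* : ∀ {p q} → 0ℚ ℚ.< p → 0ℚ ℚ.< q → 0ℚ ℚ.< p ℚ.* q
  pos* {p} {q} a b = ℚ.positive⁻¹ _ {{ℚ.pos*pos⇒pos p {{ℚ.positive a}} q {{ℚ.positive b}}}}

  0<½ : 0ℚ ℚ.< ½
  0<½ = ℚ.positive⁻¹ ½

  half : ∀ {ε} → 0ℚ ℚ.< ε → 0ℚ ℚ.< ½ ℚ.* ε
  half = pos* 0<½

  abs-up : ∀ {p e} → ∣ p ∣ ℚ.< e → 0ℚ ℚ.< e ℚ.- p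
  abs-up {p} h = diff (ℚ.≤-<-trans (p≤∣p∣ p) h)
    where
    p≤∣p∣ : ∀ p → p ℚ.≤ ∣ p ∣
    p≤∣p∣ p with ℚ.≤-total 0ℚ p
    ... | inj₁ 0≤p = ℚ.≤-reflexive (sym (ℚ.0≤p⇒∣p∣≡p 0≤p))
    ... | inj₂ p≤0 = ℚ.≤-trans p≤0 (ℚ.0≤∣p∣ p)

  abs-lo : ∀ {p e} → ∣ p ∣ ℚ.< e → 0ℚ ℚ.< e ℚ.+ p
  abs-lo {p} {e} h = subst (0ℚ ℚ.<_) (r2 p e)
    (abs-up {ℚ.- p} (subst (ℚ._< e) (sym (ℚ.∣-p∣≡∣p∣ p)) h))

  abs-intro : ∀ {p e} → 0ℚ ℚ.< e ℚ.- p → 0ℚ ℚ.< e ℚ.+ p → ∣ p ∣ ℚ.< e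
  abs-intro {p} {e} up lo with ℚ.∣p∣≡p∨∣p∣≡-p p
  ... | inj₁ eq = subst (ℚ._< e) (sym eq) (undiff up)
  ... | inj₂ eq = subst (ℚ._< e) (sym eq)
    (undiff (subst (0ℚ ℚ.<_) (sym (r2 p e)) lo))

  tri : ∀ {p q d e} → ∣ p ∣ ℚ.< d → ∣ q ∣ ℚ.< e → ∣ p ℚ.+ q ∣ ℚ.< d ℚ.+ e
  tri {p} {q} a b = ℚ.≤-<-trans (ℚ.∣p+q∣≤∣p∣+∣q∣ p q) (ℚ.+-mono-< a b)

  tri½ : ∀ {p q e} → ∣ p ∣ ℚ.< ½ ℚ.* e → ∣ q ∣ ℚ.< ½ ℚ.* e → ∣ p ℚ.+ q ∣ ℚ.< e
  tri½ {p} {q} {e} a b = subst (∣ p ℚ.+ q ∣ ℚ.<_) (halves e) (tri a b)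

  abs-swap : ∀ {e} p q → ∣ p ℚ.- q ∣ ℚ.< e → ∣ q ℚ.- p ∣ ℚ.< e
  abs-swap {e} p q = subst (ℚ._< e) (trans (sym (ℚ.∣-p∣≡∣p∣ (p ℚ.- q)))
    (cong ∣_∣ (r3 p q)))

  abs-mul : ∀ {p q B d} → ∣ p ∣ ℚ.< B → ∣ q ∣ ℚ.< d → ∣ p ℚ.* q ∣ ℚ.< B ℚ.* d
  abs-mul {p} {q} {B} {d} a b = subst (ℚ._< B ℚ.* d) (sym (ℚ.∣p*q∣≡∣p∣*∣q∣ p q))
    (ℚ.≤-<-trans
      (ℚ.*-monoʳ-≤-nonNeg ∣ q ∣ {{ℚ.∣-∣-nonNeg q}} (ℚ.<⇒≤ a))
      (ℚ.*-monoʳ-<-pos B {{ℚ.positive (ℚ.≤-<-trans (ℚ.0≤∣p∣ p) a)}} b))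

  ratio : ∀ ε B → 0ℚ ℚ.< ε → 0ℚ ℚ.< B → ∃[ δ ] 0ℚ ℚ.< δ × B ℚ.* δ ≡ ε
  ratio ε B 0<ε 0<B = ε ℚ.* inv , pos* 0<ε (ℚ.positive⁻¹ inv {{ℚ.1/pos⇒pos B}}) ,
    trans (r4 B ε inv)
      (trans (cong (ε ℚ.*_) (ℚ.*-inverseʳ B)) (ℚ.*-identityʳ ε))
    where
    instance
      posB : ℚ.Positive B
      posB = ℚ.positive 0<B
      nzB : ℚ.NonZero B
      nzB = ℚ.pos⇒nonZero B
    inv : ℚ
    inv = ℚ.1/ B

  <+1 : ∀ p → p ℚ.< p ℚ.+ 1ℚ
  <+1 p = subst (ℚ._< p ℚ.+ 1ℚ) (ℚ.+-identityʳ p) (ℚ.+-monoʳ-< p (ℚ.positive⁻¹ 1ℚ))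

  bound-step : ∀ a b → ∣ a ℚ.- b ∣ ℚ.< 1ℚ → ∣ a ∣ ℚ.< ∣ b ∣ ℚ.+ 1ℚ ℚ.+ 1ℚ
  bound-step a b h = subst₂ (λ p q → ∣ p ∣ ℚ.< q) (r1 b a) (r5 ∣ b ∣)
    (tri {a ℚ.- b} {b} h (<+1 ∣ b ∣))

  bounded : ∀ x → ∃[ B ] 0ℚ ℚ.< B × Eventually λ n → ∣ seq x n ∣ ℚ.< B
  bounded x =
    let (N , c) = cauchy x 1ℚ (ℚ.positive⁻¹ 1ℚ) in
    ∣ seq x N ∣ ℚ.+ 1ℚ ℚ.+ 1ℚ ,
    ℚ.≤-<-trans (ℚ.0≤∣p∣ (seq x N)) (ℚ.<-trans (<+1 _) (<+1 _)) ,
    N , λ n le → bound-step (seq x n) (seq x N) (c n N le ℕ.≤-refl)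

  prod-close : ∀ {a b c d B δ ε} → B ℚ.* δ ≡ ½ ℚ.* ε →
    ∣ a ∣ ℚ.< B → ∣ d ∣ ℚ.< B → ∣ a ℚ.- c ∣ ℚ.< δ → ∣ b ℚ.- d ∣ ℚ.< δ →
    ∣ a ℚ.* b ℚ.- c ℚ.* d ∣ ℚ.< ε
  prod-close {a} {b} {c} {d} {B} {δ} {ε} eq a<B d<B ac bd =
    subst (λ p → ∣ p ∣ ℚ.< ε) (r6 a b c d)
      (tri½ {a ℚ.* (b ℚ.- d)} {d ℚ.* (a ℚ.- c)}
            (subst (∣ a ℚ.* (b ℚ.- d) ∣ ℚ.<_) eq (abs-mul {a} {b ℚ.- d} a<B bd))
            (subst (∣ d ℚ.* (a ℚ.- c) ∣ ℚ.<_) eq (abs-mul {d} {a ℚ.- c} d<B ac)))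

  bounded₂ : ∀ x y → ∃[ B ] 0ℚ ℚ.< B × Eventually λ n → ∣ seq x n ∣ ℚ.< B × ∣ seq y n ∣ ℚ.< B
  bounded₂ x y =
    let (A , 0<A , a) = bounded x
        (B , 0<B , b) = bounded y
    in A ℚ.+ B , pos+ 0<A 0<B , evMap (λ n → λ (p , q) →
      ℚ.<-trans p (subst (ℚ._< A ℚ.+ B) (ℚ.+-identityʳ A) (ℚ.+-monoʳ-< A 0<B)) ,
      ℚ.<-trans q (subst (ℚ._< A ℚ.+ B) (ℚ.+-identityˡ B) (ℚ.+-monoˡ-< B 0<A))) (both a b)

  const-cauchy : ∀ q ε → 0ℚ ℚ.< ε →
    ∃[ N ] ∀ m n → N ℕ.≤ m → N ℕ.≤ n → ∣ q ℚ.- q ∣ ℚ.< ε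
  const-cauchy q ε 0<ε = 0 , λ _ _ _ _ → subst (λ p → ∣ p ∣ ℚ.< ε) (sym (ℚ.+-inverseʳ q)) 0<ε

  sum-close : ∀ {ε} a b c d → ∣ a ℚ.- b ∣ ℚ.< ½ ℚ.* ε → ∣ c ℚ.- d ∣ ℚ.< ½ ℚ.* ε →
    ∣ (a ℚ.+ c) ℚ.- (b ℚ.+ d) ∣ ℚ.< ε
  sum-close {ε} a b c d p q = subst (λ p → ∣ p ∣ ℚ.< ε) (r7 a b c d)
    (tri½ {a ℚ.- b} {c ℚ.- d} p q)

  +-cauchy : ∀ x y ε → 0ℚ ℚ.< ε → ∃[ N ] ∀ m n → N ℕ.≤ m → N ℕ.≤ n →
    ∣ (seq x m ℚ.+ seq y m) ℚ.- (seq x n ℚ.+ seq y n) ∣ ℚ.< ε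
  +-cauchy x y ε 0<ε =
    let (M , c) = cauchy x (½ ℚ.* ε) (half 0<ε)
        (N , d) = cauchy y (½ ℚ.* ε) (half 0<ε)
    in M ℕ.⊔ N , λ m n lm ln →
      sum-close (seq x m) (seq x n) (seq y m) (seq y n)
        (c m n (ℕ.m⊔n≤o⇒m≤o M N lm) (ℕ.m⊔n≤o⇒m≤o M N ln))
        (d m n (ℕ.m⊔n≤o⇒n≤o M N lm) (ℕ.m⊔n≤o⇒n≤o M N ln))

  neg-close : ∀ {ε} a b → ∣ b ℚ.- a ∣ ℚ.< ε → ∣ (ℚ.- a) ℚ.- (ℚ.- b) ∣ ℚ.< ε
  neg-close {ε} a b = subst (λ p → ∣ p ∣ ℚ.< ε) (r8 a b)

  neg-cauchy : ∀ x ε → 0ℚ ℚ.< ε → ∃[ N ] ∀ m n → N ℕ.≤ m → N ℕ.≤ n →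
    ∣ (ℚ.- seq x m) ℚ.- (ℚ.- seq x n) ∣ ℚ.< ε
  neg-cauchy x ε 0<ε =
    let (N , c) = cauchy x ε 0<ε
    in N , λ m n lm ln → neg-close (seq x m) (seq x n) (c n m ln lm)

  *-cauchy : ∀ x y ε → 0ℚ ℚ.< ε → ∃[ N ] ∀ m n → N ℕ.≤ m → N ℕ.≤ n →
    ∣ seq x m ℚ.* seq y m ℚ.- seq x n ℚ.* seq y n ∣ ℚ.< ε
  *-cauchy x y ε 0<ε =
    let (B , 0<B , K , bd) = bounded₂ x y
        (δ , 0<δ , eq) = ratio (½ ℚ.* ε) B (half 0<ε) 0<B
        (M , c) = cauchy x δ 0<δ
        (N , d) = cauchy y δ 0<δ
        L = M ℕ.⊔ N
    in K ℕ.⊔ L , λ m n lm ln →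
      let lm′ = ℕ.m⊔n≤o⇒n≤o K L lm
          ln′ = ℕ.m⊔n≤o⇒n≤o K L ln
      in prod-close {seq x m} {seq y m} {seq x n} {seq y n} eq
        (proj₁ (bd m (ℕ.m⊔n≤o⇒m≤o K L lm)))
        (proj₂ (bd n (ℕ.m⊔n≤o⇒m≤o K L ln)))
        (c m n (ℕ.m⊔n≤o⇒m≤o M N lm′) (ℕ.m⊔n≤o⇒m≤o M N ln′))
        (d m n (ℕ.m⊔n≤o⇒n≤o M N lm′) (ℕ.m⊔n≤o⇒n≤o M N ln′))

  *-cancel-< : ∀ {p q} r → 0ℚ ℚ.< r → r ℚ.* p ℚ.< r ℚ.* q → p ℚ.< q
  *-cancel-< r 0<r = ℚ.*-cancelˡ-<-nonNeg r {{ℚ.pos⇒nonNeg r {{ℚ.positive 0<r}}}}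

  recip-diff : ∀ a b i j → a ℚ.* i ≡ 1ℚ → b ℚ.* j ≡ 1ℚ → 0ℚ ℚ.< a ℚ.* b →
    ∣ a ℚ.- b ∣ ≡ (a ℚ.* b) ℚ.* ∣ i ℚ.- j ∣
  recip-diff a b i j ai bj 0<ab = begin
    ∣ a ℚ.- b ∣                             ≡⟨ ℚ.∣-p∣≡∣p∣ (a ℚ.- b) ⟨
    ∣ ℚ.- (a ℚ.- b) ∣                       ≡⟨ cong ∣_∣ (r9 a b) ⟩
    ∣ 1ℚ ℚ.* b ℚ.- 1ℚ ℚ.* a ∣               ≡⟨ cong₂ (λ u v → ∣ u ℚ.* b ℚ.- v ℚ.* a ∣) ai bj ⟨
    ∣ (a ℚ.* i) ℚ.* b ℚ.- (b ℚ.* j) ℚ.* a ∣ ≡⟨ cong ∣_∣ (r10 a b i j) ⟩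
    ∣ (a ℚ.* b) ℚ.* (i ℚ.- j) ∣             ≡⟨ ℚ.∣p*q∣≡∣p∣*∣q∣ (a ℚ.* b) (i ℚ.- j) ⟩
    ∣ a ℚ.* b ∣ ℚ.* ∣ i ℚ.- j ∣             ≡⟨ cong (ℚ._* ∣ i ℚ.- j ∣) (ℚ.0≤p⇒∣p∣≡p (ℚ.<⇒≤ 0<ab)) ⟩
    (a ℚ.* b) ℚ.* ∣ i ℚ.- j ∣               ∎
    where open ≡-Reasoning

  mul-< : ∀ {η θ a b} → 0ℚ ℚ.< η → 0ℚ ℚ.< θ → η ℚ.< a → θ ℚ.< b → η ℚ.* θ ℚ.< a ℚ.* b
  mul-< {η} {θ} {a} {b} 0<η 0<θ η<a θ<b = ℚ.<-trans
    (ℚ.*-monoˡ-<-pos θ {{ℚ.positive 0<θ}} η<a)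
    (ℚ.*-monoʳ-<-pos a {{ℚ.positive (ℚ.<-trans 0<η η<a)}} θ<b)

  recip-close : ∀ a b i j {η ε} → a ℚ.* i ≡ 1ℚ → b ℚ.* j ≡ 1ℚ →
    0ℚ ℚ.< η → 0ℚ ℚ.< ε → η ℚ.< a → η ℚ.< b →
    ∣ a ℚ.- b ∣ ℚ.< (η ℚ.* η) ℚ.* ε → ∣ i ℚ.- j ∣ ℚ.< ε
  recip-close a b i j {η} {ε} ai bj 0<η 0<ε η<a η<b h =
    *-cancel-< (a ℚ.* b) 0<ab
      (subst (ℚ._< (a ℚ.* b) ℚ.* ε) (recip-diff a b i j ai bj 0<ab)
        (ℚ.<-trans h (ℚ.*-monoˡ-<-pos ε {{ℚ.positive 0<ε}} (mul-< 0<η 0<η η<a η<b))))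
    where
    0<ab : 0ℚ ℚ.< a ℚ.* b
    0<ab = pos* (ℚ.<-trans 0<η η<a) (ℚ.<-trans 0<η η<b)

-- Reciprocal on ℚ, extended by the junk value 0 at 0.
1/₀_ : ℚ → ℚ
1/₀ q with q ℚ.≟ 0ℚ
... | yes _  = 0ℚ
... | no q≢0 = ℚ.1/_ q {{ℚ.≢-nonZero q≢0}}

abstract
 private
  1/₀-inverse : ∀ q → 0ℚ ℚ.< q → q ℚ.* 1/₀ q ≡ 1ℚ
  1/₀-inverse q 0<q with q ℚ.≟ 0ℚ
  ... | yes q≡0 = contradiction (sym q≡0) (ℚ.<⇒≢ 0<q)
  ... | no q≢0  = ℚ.*-inverseʳ q {{ℚ.≢-nonZero q≢0}}

  recip-cauchy : ∀ (f : ℕ → ℚ) x {η} → 0ℚ ℚ.< η →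
    (Eventually λ n → 0ℚ ℚ.+ η ℚ.< seq x n) →
    (∀ n → 0ℚ ℚ.< seq x n → seq x n ℚ.* f n ≡ 1ℚ) →
    ∀ ε → 0ℚ ℚ.< ε → ∃[ N ] ∀ m n → N ℕ.≤ m → N ℕ.≤ n → ∣ f m ℚ.- f n ∣ ℚ.< ε
  recip-cauchy f x {η} 0<η (K , η<x) inv ε 0<ε =
    let (M , c) = cauchy x ((η ℚ.* η) ℚ.* ε) (pos* (pos* 0<η 0<η) 0<ε)
        big : ∀ n → K ℕ.≤ n → η ℚ.< seq x n
        big n le = subst (ℚ._< seq x n) (ℚ.+-identityˡ η) (η<x n le)
    in K ℕ.⊔ M , λ m n lm ln →
      let xm = big m (ℕ.m⊔n≤o⇒m≤o K M lm)
          xn = big n (ℕ.m⊔n≤o⇒m≤o K M ln)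
      in recip-close (seq x m) (seq x n) (f m) (f n)
           (inv m (ℚ.<-trans 0<η xm)) (inv n (ℚ.<-trans 0<η xn)) 0<η 0<ε xm xn
           (c m n (ℕ.m⊔n≤o⇒n≤o K M lm) (ℕ.m⊔n≤o⇒n≤o K M ln))

infixl 6 _+ℝ_
infixl 7 _*ℝ_
infix  8 -ℝ_

constℝ : ℚ → ℝ
constℝ q .seq _  = q
constℝ q .cauchy = const-cauchy q

0ℝ 1ℝ : ℝ
0ℝ = constℝ 0ℚ
1ℝ = constℝ 1ℚ

_+ℝ_ : ℝ → ℝ → ℝ
(x +ℝ y) .seq n  = seq x n ℚ.+ seq y n
(x +ℝ y) .cauchy = +-cauchy x y

-ℝ_ : ℝ → ℝ
(-ℝ x) .seq n  = ℚ.- seq x n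
(-ℝ x) .cauchy = neg-cauchy x

_*ℝ_ : ℝ → ℝ → ℝ
(x *ℝ y) .seq n  = seq x n ℚ.* seq y n
(x *ℝ y) .cauchy = *-cauchy x y

recipℝ : ∀ x → 0ℝ <ℝ x → ℝ
recipℝ x _ .seq n                = 1/₀ seq x n
recipℝ x (η , 0<η , η<x) .cauchy =
  recip-cauchy (λ n → 1/₀ seq x n) x 0<η η<x (λ n → 1/₀-inverse (seq x n))

abstract
 private
  pointwise : ∀ {x y} → (∀ n → seq x n ≡ seq y n) → x ≈ℝ y
  pointwise {x} {y} eq ε 0<ε = 0 , λ n _ → subst (λ p → ∣ p ∣ ℚ.< ε)
    (trans (sym (ℚ.+-inverseʳ (seq x n))) (cong (λ q → seq x n ℚ.- q) (eq n))) 0<ε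

  ≈ℝ-refl : ∀ {x} → x ≈ℝ x
  ≈ℝ-refl {x} = pointwise {x} {x} (λ _ → refl)

  ≈ℝ-sym : ∀ {x y} → x ≈ℝ y → y ≈ℝ x
  ≈ℝ-sym {x} {y} p ε 0<ε = evMap (λ n → abs-swap (seq x n) (seq y n)) (p ε 0<ε)

  trans-close : ∀ {ε} a b c → ∣ a ℚ.- b ∣ ℚ.< ½ ℚ.* ε → ∣ b ℚ.- c ∣ ℚ.< ½ ℚ.* ε → ∣ a ℚ.- c ∣ ℚ.< ε
  trans-close {ε} a b c p q = subst (λ p → ∣ p ∣ ℚ.< ε)
    (r11 a b c) (tri½ {a ℚ.- b} {b ℚ.- c} p q)
    where
    r11 : ∀ a b c → (a ℚ.- b) ℚ.+ (b ℚ.- c) ≡ a ℚ.- c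
    r11 = solve 3 (λ a b c → (a :- b) :+ (b :- c) := a :- c) refl

  ≈ℝ-trans : ∀ {x y z} → x ≈ℝ y → y ≈ℝ z → x ≈ℝ z
  ≈ℝ-trans {x} {y} {z} p q ε 0<ε =
    evMap (λ n → λ (a , b) → trans-close (seq x n) (seq y n) (seq z n) a b)
      (both (p (½ ℚ.* ε) (half 0<ε)) (q (½ ℚ.* ε) (half 0<ε)))

  +ℝ-cong : ∀ {x x′ y y′} → x ≈ℝ x′ → y ≈ℝ y′ → (x +ℝ y) ≈ℝ (x′ +ℝ y′)
  +ℝ-cong {x} {x′} {y} {y′} p q ε 0<ε =
    evMap (λ n → λ (a , b) → sum-close (seq x n) (seq x′ n) (seq y n) (seq y′ n) a b)
      (both (p (½ ℚ.* ε) (half 0<ε)) (q (½ ℚ.* ε) (half 0<ε)))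

  -ℝ-cong : ∀ {x y} → x ≈ℝ y → (-ℝ x) ≈ℝ (-ℝ y)
  -ℝ-cong {x} {y} p ε 0<ε =
    evMap (λ n a → neg-close (seq x n) (seq y n) (abs-swap (seq x n) (seq y n) a)) (p ε 0<ε)

  *ℝ-cong : ∀ {x x′ y y′} → x ≈ℝ x′ → y ≈ℝ y′ → (x *ℝ y) ≈ℝ (x′ *ℝ y′)
  *ℝ-cong {x} {x′} {y} {y′} p q ε 0<ε =
    let (B , 0<B , bd) = bounded₂ x y′
        (δ , 0<δ , eq) = ratio (½ ℚ.* ε) B (half 0<ε) 0<B
    in evMap (λ n → λ ((a , d) , (ac , bd)) →
         prod-close {seq x n} {seq y n} {seq x′ n} {seq y′ n} eq a d ac bd)
       (both bd (both (p δ 0<δ) (q δ 0<δ)))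

  ≈ℝ-isEquivalence : IsEquivalence _≈ℝ_
  ≈ℝ-isEquivalence = record
    { refl  = λ {x} → ≈ℝ-refl {x}
    ; sym   = λ {x} {y} → ≈ℝ-sym {x} {y}
    ; trans = λ {x} {y} {z} → ≈ℝ-trans {x} {y} {z}
    }

  ℝ-isCommutativeRing : IsCommutativeRing _≈ℝ_ _+ℝ_ _*ℝ_ -ℝ_ 0ℝ 1ℝ
  ℝ-isCommutativeRing = record
    { isRing = record
      { +-isAbelianGroup = record
        { isGroup = record
          { isMonoid = record
            { isSemigroup = record
              { isMagma = record
                { isEquivalence = ≈ℝ-isEquivalence
                ; ∙-cong        = λ {x} {x′} {y} {y′} → +ℝ-cong {x} {x′} {y} {y′}
                }
              ; assoc = λ x y z → pointwise {(x +ℝ y) +ℝ z} {x +ℝ (y +ℝ z)}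
                  λ n → ℚ.+-assoc (seq x n) (seq y n) (seq z n)
              }
            ; identity = (λ x → pointwise {0ℝ +ℝ x} {x} λ n → ℚ.+-identityˡ (seq x n))
                       , (λ x → pointwise {x +ℝ 0ℝ} {x} λ n → ℚ.+-identityʳ (seq x n))
            }
          ; inverse = (λ x → pointwise {(-ℝ x) +ℝ x} {0ℝ} λ n → ℚ.+-inverseˡ (seq x n))
                    , (λ x → pointwise {x +ℝ (-ℝ x)} {0ℝ} λ n → ℚ.+-inverseʳ (seq x n))
          ; ⁻¹-cong = λ {x} {y} → -ℝ-cong {x} {y}
          }
        ; comm = λ x y → pointwise {x +ℝ y} {y +ℝ x} λ n → ℚ.+-comm (seq x n) (seq y n)
        }
      ; *-cong = λ {x} {x′} {y} {y′} → *ℝ-cong {x} {x′} {y} {y′}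
      ; *-assoc = λ x y z → pointwise {(x *ℝ y) *ℝ z} {x *ℝ (y *ℝ z)}
          λ n → ℚ.*-assoc (seq x n) (seq y n) (seq z n)
      ; *-identity = (λ x → pointwise {1ℝ *ℝ x} {x} λ n → ℚ.*-identityˡ (seq x n))
                   , (λ x → pointwise {x *ℝ 1ℝ} {x} λ n → ℚ.*-identityʳ (seq x n))
      ; distrib = (λ x y z → pointwise {x *ℝ (y +ℝ z)} {(x *ℝ y) +ℝ (x *ℝ z)}
                    λ n → ℚ.*-distribˡ-+ (seq x n) (seq y n) (seq z n))
                , (λ x y z → pointwise {(y +ℝ z) *ℝ x} {(y *ℝ x) +ℝ (z *ℝ x)}
                    λ n → ℚ.*-distribʳ-+ (seq x n) (seq y n) (seq z n))
      }
    ; *-comm = λ x y → pointwise {x *ℝ y} {y *ℝ x} λ n → ℚ.*-comm (seq x n) (seq y n)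
    }

ℝ-commutativeRing : CommutativeRing 0ℓ 0ℓ
ℝ-commutativeRing = record { isCommutativeRing = ℝ-isCommutativeRing }

open RawMonoidDefs ℚ.+-0-rawMonoid using () renaming (_×_ to _×ℚ_)
open RawMonoidDefs (CommutativeRing.+-rawMonoid ℝ-commutativeRing) using () renaming (_×_ to _×ℝ_)

abstract
 private
  irrefl-close : ∀ a b ε → ∣ a ℚ.- b ∣ ℚ.< ε → ¬ (a ℚ.+ ε ℚ.< b)
  irrefl-close a b ε close lt = ℚ.<-irrefl refl
    (subst (0ℚ ℚ.<_) (r a b ε) (pos+ (abs-lo {a ℚ.- b} close) (diff lt)))
    where
    r : ∀ a b ε → (ε ℚ.+ (a ℚ.- b)) ℚ.+ (b ℚ.- (a ℚ.+ ε)) ≡ 0ℚ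
    r = solve 3 (λ a b e → (e :+ (a :- b)) :+ (b :- (a :+ e)) := con 0ℚ) refl

  <ℝ-irrefl : ∀ {x y} → x ≈ℝ y → ¬ (x <ℝ y)
  <ℝ-irrefl {x} {y} x≈y (ε , 0<ε , lt) =
    let (N , h) = both (x≈y ε 0<ε) lt
        (a , b) = h N ℕ.≤-refl
    in irrefl-close (seq x N) (seq y N) ε a b

  <ℝ-trans : ∀ {x y z} → x <ℝ y → y <ℝ z → x <ℝ z
  <ℝ-trans {x} {y} {z} (ε , 0<ε , p) (δ , 0<δ , q) = ε , 0<ε ,
    evMap (λ n → λ (a , b) → ℚ.<-trans a (ℚ.<-trans
      (subst (ℚ._< seq y n ℚ.+ δ) (ℚ.+-identityʳ (seq y n)) (ℚ.+-monoʳ-< (seq y n) 0<δ)) b))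
      (both p q)

  respʳ-close : ∀ a b c ε → a ℚ.+ ε ℚ.< b → ∣ b ℚ.- c ∣ ℚ.< ½ ℚ.* ε → a ℚ.+ ½ ℚ.* ε ℚ.< c
  respʳ-close a b c ε lt close = undiff
    (subst (0ℚ ℚ.<_) (r a b c ε) (pos+ (diff lt) (abs-up {b ℚ.- c} close)))
    where
    r : ∀ a b c ε → (b ℚ.- (a ℚ.+ ε)) ℚ.+ (½ ℚ.* ε ℚ.- (b ℚ.- c)) ≡ c ℚ.- (a ℚ.+ ½ ℚ.* ε)
    r = solve 4 (λ a b c e → (b :- (a :+ e)) :+ (con ½ :* e :- (b :- c)) := c :- (a :+ con ½ :* e)) refl

  respˡ-close : ∀ a b c ε → a ℚ.+ ε ℚ.< b → ∣ a ℚ.- c ∣ ℚ.< ½ ℚ.* ε → c ℚ.+ ½ ℚ.* ε ℚ.< b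
  respˡ-close a b c ε lt close = undiff
    (subst (0ℚ ℚ.<_) (r a b c ε) (pos+ (diff lt) (abs-lo {a ℚ.- c} close)))
    where
    r : ∀ a b c ε → (b ℚ.- (a ℚ.+ ε)) ℚ.+ (½ ℚ.* ε ℚ.+ (a ℚ.- c)) ≡ b ℚ.- (c ℚ.+ ½ ℚ.* ε)
    r = solve 4 (λ a b c e → (b :- (a :+ e)) :+ (con ½ :* e :+ (a :- c)) := b :- (c :+ con ½ :* e)) refl

  <ℝ-respʳ : ∀ {x y z} → y ≈ℝ z → x <ℝ y → x <ℝ z
  <ℝ-respʳ {x} {y} {z} y≈z (ε , 0<ε , p) = ½ ℚ.* ε , half 0<ε ,
    evMap (λ n → λ (a , b) → respʳ-close (seq x n) (seq y n) (seq z n) ε a b)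
      (both p (y≈z (½ ℚ.* ε) (half 0<ε)))

  <ℝ-respˡ : ∀ {x y z} → y ≈ℝ z → y <ℝ x → z <ℝ x
  <ℝ-respˡ {x} {y} {z} y≈z (ε , 0<ε , p) = ½ ℚ.* ε , half 0<ε ,
    evMap (λ n → λ (a , b) → respˡ-close (seq y n) (seq x n) (seq z n) ε a b)
      (both p (y≈z (½ ℚ.* ε) (half 0<ε)))

  <ℝ-isStrictPartialOrder : IsStrictPartialOrder _≈ℝ_ _<ℝ_
  <ℝ-isStrictPartialOrder = record
    { isEquivalence = ≈ℝ-isEquivalence
    ; irrefl        = λ {x} {y} → <ℝ-irrefl {x} {y}
    ; trans         = λ {x} {y} {z} → <ℝ-trans {x} {y} {z}
    ; <-resp-≈      = (λ {x} {y} {z} → <ℝ-respʳ {x} {y} {z})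
                    , (λ {x} {y} {z} → <ℝ-respˡ {x} {y} {z})
    }

  eighth : ℚ → ℚ
  eighth ε = ½ ℚ.* (½ ℚ.* (½ ℚ.* ε))

  0<eighth : ∀ {ε} → 0ℚ ℚ.< ε → 0ℚ ℚ.< eighth ε
  0<eighth 0<ε = half (half (half 0<ε))

  nonNeg+pos : ∀ {p q} → 0ℚ ℚ.≤ p → 0ℚ ℚ.< q → 0ℚ ℚ.< p ℚ.+ q
  nonNeg+pos = ℚ.+-mono-≤-<

  diff≤ : ∀ {p q} → p ℚ.≤ q → 0ℚ ℚ.≤ q ℚ.- p
  diff≤ {p} {q} p≤q = subst (ℚ._≤ q ℚ.- p) (ℚ.+-inverseʳ p) (ℚ.+-monoˡ-≤ (ℚ.- p) p≤q)

  separate : ∀ a b A B ε → 0ℚ ℚ.< ε → A ℚ.+ ½ ℚ.* ε ℚ.≤ B →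
    ∣ a ℚ.- A ∣ ℚ.< eighth ε → ∣ b ℚ.- B ∣ ℚ.< eighth ε → a ℚ.+ eighth ε ℚ.< b
  separate a b A B ε 0<ε sep ca cb = undiff (subst (0ℚ ℚ.<_) (r a b A B ε)
    (nonNeg+pos (diff≤ sep)
      (pos+ (pos+ (abs-up {a ℚ.- A} ca) (abs-lo {b ℚ.- B} cb)) (0<eighth 0<ε))))
    where
    r : ∀ a b A B ε →
      (B ℚ.- (A ℚ.+ ½ ℚ.* ε)) ℚ.+ (((eighth ε ℚ.- (a ℚ.- A)) ℚ.+ (eighth ε ℚ.+ (b ℚ.- B))) ℚ.+ eighth ε)
      ≡ b ℚ.- (a ℚ.+ eighth ε)
    r = solve 5 (λ a b A B e → let d = con ½ :* (con ½ :* (con ½ :* e)) in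
      (B :- (A :+ con ½ :* e)) :+ (((d :- (a :- A)) :+ (d :+ (b :- B))) :+ d) := b :- (a :+ d)) refl

  near : ∀ a b A B ε → 0ℚ ℚ.< ε → A ℚ.< B ℚ.+ ½ ℚ.* ε →
    ∣ a ℚ.- A ∣ ℚ.< eighth ε → ∣ b ℚ.- B ∣ ℚ.< eighth ε → 0ℚ ℚ.< ε ℚ.- (a ℚ.- b)
  near a b A B ε 0<ε h ca cb = subst (0ℚ ℚ.<_) (r a b A B ε)
    (pos+ (diff h) (pos+ (pos+ (abs-up {a ℚ.- A} ca) (abs-lo {b ℚ.- B} cb)) (half (half 0<ε))))
    where
    r : ∀ a b A B ε →
      (B ℚ.+ ½ ℚ.* ε ℚ.- A) ℚ.+ (((eighth ε ℚ.- (a ℚ.- A)) ℚ.+ (eighth ε ℚ.+ (b ℚ.- B))) ℚ.+ ½ ℚ.* (½ ℚ.* ε))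
      ≡ ε ℚ.- (a ℚ.- b)
    r = solve 5 (λ a b A B e → let d = con ½ :* (con ½ :* (con ½ :* e)) in
      (B :+ con ½ :* e :- A) :+ (((d :- (a :- A)) :+ (d :+ (b :- B))) :+ con ½ :* (con ½ :* e)) := e :- (a :- b)) refl

  upper-half : ∀ A B C ε → C ℚ.≤ A ℚ.+ ½ ℚ.* ε → A ℚ.+ ε ℚ.< B → C ℚ.+ ½ ℚ.* ε ℚ.≤ B
  upper-half A B C ε p q = ℚ.<⇒≤ (undiff (subst (0ℚ ℚ.<_) (r A B C ε) (nonNeg+pos (diff≤ p) (diff q))))
    where
    r : ∀ A B C ε → (A ℚ.+ ½ ℚ.* ε ℚ.- C) ℚ.+ (B ℚ.- (A ℚ.+ ε)) ≡ B ℚ.- (C ℚ.+ ½ ℚ.* ε)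
    r = solve 4 (λ A B C e → (A :+ con ½ :* e :- C) :+ (B :- (A :+ e)) := B :- (C :+ con ½ :* e)) refl

  settle : ∀ x y ε → 0ℚ ℚ.< ε → ∃[ N ] ∀ M → N ℕ.≤ M → Eventually λ n →
    ∣ seq x n ℚ.- seq x M ∣ ℚ.< ε × ∣ seq y n ℚ.- seq y M ∣ ℚ.< ε
  settle x y ε 0<ε =
    let (K , c) = cauchy x ε 0<ε
        (L , d) = cauchy y ε 0<ε
    in K ℕ.⊔ L , λ M lM → K ℕ.⊔ L , λ n ln →
      c n M (ℕ.m⊔n≤o⇒m≤o K L ln) (ℕ.m⊔n≤o⇒m≤o K L lM) ,
      d n M (ℕ.m⊔n≤o⇒n≤o K L ln) (ℕ.m⊔n≤o⇒n≤o K L lM)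

  separateℝ : ∀ x y ε M → 0ℚ ℚ.< ε → seq x M ℚ.+ ½ ℚ.* ε ℚ.≤ seq y M →
    (Eventually λ n → ∣ seq x n ℚ.- seq x M ∣ ℚ.< eighth ε × ∣ seq y n ℚ.- seq y M ∣ ℚ.< eighth ε) →
    x <ℝ y
  separateℝ x y ε M 0<ε sep ev = eighth ε , 0<eighth 0<ε ,
    evMap (λ n → λ (a , b) → separate (seq x n) (seq y n) (seq x M) (seq y M) ε 0<ε sep a b) ev

  <ℝ-cotrans : ∀ {x y} → x <ℝ y → ∀ z → x <ℝ z ⊎ z <ℝ y
  <ℝ-cotrans {x} {y} (ε , 0<ε , K , lt) z =
    let (A , xz) = settle x z (eighth ε) (0<eighth 0<ε)
        (B , zy) = settle z y (eighth ε) (0<eighth 0<ε)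
        M = K ℕ.⊔ (A ℕ.⊔ B)
        A⊔B≤M = ℕ.m≤n⊔m K (A ℕ.⊔ B)
        evxz = xz M (ℕ.m⊔n≤o⇒m≤o A B A⊔B≤M)
        evzy = zy M (ℕ.m⊔n≤o⇒n≤o A B A⊔B≤M)
    in decide M evxz evzy (lt M (ℕ.m≤m⊔n K (A ℕ.⊔ B)))
         (ℚ.≤-total (seq x M ℚ.+ ½ ℚ.* ε) (seq z M))
    where
    decide : ∀ M →
      (Eventually λ n → ∣ seq x n ℚ.- seq x M ∣ ℚ.< eighth ε × ∣ seq z n ℚ.- seq z M ∣ ℚ.< eighth ε) →
      (Eventually λ n → ∣ seq z n ℚ.- seq z M ∣ ℚ.< eighth ε × ∣ seq y n ℚ.- seq y M ∣ ℚ.< eighth ε) →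
      seq x M ℚ.+ ε ℚ.< seq y M →
      (seq x M ℚ.+ ½ ℚ.* ε ℚ.≤ seq z M) ⊎ (seq z M ℚ.≤ seq x M ℚ.+ ½ ℚ.* ε) →
      x <ℝ z ⊎ z <ℝ y
    decide M evxz evzy xy (inj₁ le) = inj₁ (separateℝ x z ε M 0<ε le evxz)
    decide M evxz evzy xy (inj₂ le) = inj₂ (separateℝ z y ε M 0<ε
      (upper-half (seq x M) (seq y M) (seq z M) ε le xy) evzy)

  <ℝ-tight : ∀ {x y} → ¬ (x <ℝ y) → ¬ (y <ℝ x) → x ≈ℝ y
  <ℝ-tight {x} {y} x≮y y≮x ε 0<ε =
    let (M , st) = settle x y (eighth ε) (0<eighth 0<ε)
        (M′ , st′) = settle y x (eighth ε) (0<eighth 0<ε)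
        N = M ℕ.⊔ M′
        ev = st N (ℕ.m≤m⊔n M M′)
        ev′ = st′ N (ℕ.m≤n⊔m M M′)
        x<y+ = ℚ.≰⇒> (λ le → y≮x (separateℝ y x ε N 0<ε le ev′))
        y<x+ = ℚ.≰⇒> (λ le → x≮y (separateℝ x y ε N 0<ε le ev))
    in evMap (λ n → λ (a , b) → abs-intro {seq x n ℚ.- seq y n}
         (near (seq x n) (seq y n) (seq x N) (seq y N) ε 0<ε x<y+ a b)
         (subst (0ℚ ℚ.<_) (r (seq x n) (seq y n) ε)
           (near (seq y n) (seq x n) (seq y N) (seq x N) ε 0<ε y<x+ b a))) ev
    where
    r : ∀ a b ε → ε ℚ.- (b ℚ.- a) ≡ ε ℚ.+ (a ℚ.- b)
    r = solve 3 (λ a b e → e :- (b :- a) := e :+ (a :- b)) refl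

  +ℝ-monoʳ-< : ∀ z {x y} → x <ℝ y → (z +ℝ x) <ℝ (z +ℝ y)
  +ℝ-monoʳ-< z {x} {y} (ε , 0<ε , lt) = ε , 0<ε ,
    evMap (λ n a → subst (ℚ._< seq z n ℚ.+ seq y n) (sym (ℚ.+-assoc (seq z n) (seq x n) ε))
      (ℚ.+-monoʳ-< (seq z n) a)) lt

  *ℝ-pos : ∀ {x y} → 0ℝ <ℝ x → 0ℝ <ℝ y → 0ℝ <ℝ (x *ℝ y)
  *ℝ-pos {x} {y} (ε , 0<ε , p) (δ , 0<δ , q) = ε ℚ.* δ , pos* 0<ε 0<δ ,
    evMap (λ n → λ (a , b) → subst (ℚ._< seq x n ℚ.* seq y n) (sym (ℚ.+-identityˡ (ε ℚ.* δ)))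
      (mul-< 0<ε 0<δ (subst (ℚ._< seq x n) (ℚ.+-identityˡ ε) a)
                     (subst (ℚ._< seq y n) (ℚ.+-identityˡ δ) b))) (both p q)

  0ℝ<1ℝ : 0ℝ <ℝ 1ℝ
  0ℝ<1ℝ = ½ , 0<½ , 0 , λ _ _ → ½<1
    where
    ½<1 : 0ℚ ℚ.+ ½ ℚ.< 1ℚ
    ½<1 = toWitness {a? = (0ℚ ℚ.+ ½) ℚ.<? 1ℚ} _

  *ℝ-recip : ∀ x (0<x : 0ℝ <ℝ x) → (x *ℝ recipℝ x 0<x) ≈ℝ 1ℝ
  *ℝ-recip x (η , 0<η , η<x) ε 0<ε = evMap (λ n a → subst (λ p → ∣ p ℚ.- 1ℚ ∣ ℚ.< ε)
    (sym (1/₀-inverse (seq x n)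
      (ℚ.<-trans 0<η (subst (ℚ._< seq x n) (ℚ.+-identityˡ η) a)))) 0<ε) η<x

  seq-× : ∀ k n → seq (k ×ℝ 1ℝ) n ≡ k ×ℚ 1ℚ
  seq-× zero    n = refl
  seq-× (suc k) n = cong (1ℚ ℚ.+_) (seq-× k n)

  toℚᵘ-× : ∀ k → toℚᵘ (k ×ℚ 1ℚ) ℚᵘ.≃ ℚᵘ.mkℚᵘ (+ k) 0
  toℚᵘ-× zero    = ℚᵘ.≃-refl
  toℚᵘ-× (suc k) = ℚᵘ.≃-trans (ℚ.toℚᵘ-homo-+ 1ℚ (k ×ℚ 1ℚ))
    (ℚᵘ.≃-trans (ℚᵘ.+-congʳ (toℚᵘ 1ℚ) (toℚᵘ-× k))
      (ℚᵘ.≃-reflexive (cong (λ z → ℚᵘ.mkℚᵘ z 0) (cong (λ z → + 1 ℤ.+ z) (ℤ.*-identityʳ (+ k))))))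

  ℚ-archimedean : ∀ q → ∃[ k ] q ℚ.< k ×ℚ 1ℚ
  ℚ-archimedean q = suc ℤ.∣ ℚ.↥ q ∣ , ℚ.toℚᵘ-cancel-< (ℚᵘ.<-respʳ-≃
    (ℚᵘ.≃-sym (toℚᵘ-× (suc ℤ.∣ ℚ.↥ q ∣))) (lemma q))
    where
    i≤∣i∣ : ∀ i → i ℤ.≤ + ℤ.∣ i ∣
    i≤∣i∣ (+ n)    = ℤ.≤-refl
    i≤∣i∣ -[1+ n ] = ℤ.-≤+
    lemma : ∀ q → toℚᵘ q ℚᵘ.< ℚᵘ.mkℚᵘ (+ suc ℤ.∣ ℚ.↥ q ∣) 0
    lemma (mkℚ i d-1 _) = ℚᵘ.*<* (ℤ.≤-<-trans
      (ℤ.≤-trans (ℤ.≤-reflexive (ℤ.*-identityʳ i)) (i≤∣i∣ i))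
      (ℤ.+<+ (ℕ.<-≤-trans (ℕ.n<1+n ℤ.∣ i ∣) (ℕ.m≤m*n (suc ℤ.∣ i ∣) (suc d-1)))))

  arch-close : ∀ {a B c} → ∣ a ∣ ℚ.< B → B ℚ.+ 1ℚ ℚ.< c → a ℚ.+ 1ℚ ℚ.< c
  arch-close {a} {B} p q = ℚ.<-trans (ℚ.+-monoˡ-< 1ℚ (undiff {a} {B} (abs-up {a} p))) q

  ℝ-archimedean : ∀ x → ∃[ k ] x <ℝ (k ×ℝ 1ℝ)
  ℝ-archimedean x =
    let (B , 0<B , bd) = bounded x
        (k , B<k) = ℚ-archimedean (B ℚ.+ 1ℚ)
    in k , 1ℚ , ℚ.positive⁻¹ 1ℚ , evMap (λ n a →
      subst (seq x n ℚ.+ 1ℚ ℚ.<_) (sym (seq-× k n)) (arch-close {seq x n} a B<k)) bd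

ℝ-field : ArchimedeanOrderedField 0ℓ 0ℓ 0ℓ
ℝ-field = record
  { commutativeRing        = ℝ-commutativeRing
  ; _<_                    = _<ℝ_
  ; <-isStrictPartialOrder = <ℝ-isStrictPartialOrder
  ; <-cotrans              = λ {x} {y} → <ℝ-cotrans {x} {y}
  ; <-tight                = λ {x} {y} → <ℝ-tight {x} {y}
  ; +-monoʳ-<              = λ z {x} {y} → +ℝ-monoʳ-< z {x} {y}
  ; *-pos                  = λ {x} {y} → *ℝ-pos {x} {y}
  ; 0<1                    = 0ℝ<1ℝ
  ; recip                  = recipℝ
  ; *-recip                = *ℝ-recip
  ; archimedean            = ℝ-archimedean
  }

module Process {c ℓ₁ ℓ₂} (F : ArchimedeanOrderedField c ℓ₁ ℓ₂) where

  open ArchimedeanOrderedField F hiding (refl; sym; trans)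
  open RawMonoidDefs +-rawMonoid using (sum)
  open RawMonoidDefs *-rawMonoid using () renaming (sum to product)
  open import Algebra.Properties.Semiring.Exp semiring using (_^_)

  infix 7 _/_[_] _/ℕ_

  _/_[_] : ∀ (x y : Carrier) → 0# < y → Carrier
  x / y [ 0<y ] = x * recip y 0<y

  private
    module ≈ = CommutativeRing commutativeRing
    module SPO = IsStrictPartialOrder <-isStrictPartialOrder

  0<fromℕ-suc : ∀ n → 0# < fromℕ (suc n)
  0<fromℕ-suc zero    = SPO.<-respʳ-≈ (≈.sym (+-identityʳ 1#)) 0<1
  0<fromℕ-suc (suc n) = SPO.trans (SPO.<-respʳ-≈ (≈.sym (+-identityʳ 1#)) 0<1)
                                  (+-monoʳ-< 1# (0<fromℕ-suc n))

  _/ℕ_ : ∀ (k n : ℕ) .{{_ : ℕ.NonZero n}} → Carrier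
  k /ℕ suc n = fromℕ k / fromℕ (suc n) [ 0<fromℕ-suc n ]

  /ℕ<⇒0<* : ∀ k n {y} → suc k /ℕ suc n < y → 0# < fromℕ (suc n) * y
  /ℕ<⇒0<* k n {y} k/n<y = SPO.trans (0<fromℕ-suc k) k<n*y
    where
    open ≈-Reasoning ≈.setoid
    a = fromℕ (suc k)
    b = fromℕ (suc n)
    q = suc k /ℕ suc n

    b*q≈a : b * q ≈ a
    b*q≈a = begin
      b * (a * recip b _) ≈⟨ *-assoc b a _ ⟨
      b * a * recip b _   ≈⟨ *-congʳ (*-comm b a) ⟩
      a * b * recip b _   ≈⟨ *-assoc a b _ ⟩
      a * (b * recip b _) ≈⟨ *-congˡ (*-recip b _) ⟩
      a * 1#              ≈⟨ *-identityʳ a ⟩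
      a                   ∎

    0<y-q : 0# < - q + y
    0<y-q = SPO.<-respˡ-≈ (-‿inverseˡ q) (+-monoʳ-< (- q) k/n<y)

    b*q+[b*[y-q]]≈b*y : b * q + b * (- q + y) ≈ b * y
    b*q+[b*[y-q]]≈b*y = begin
      b * q + b * (- q + y) ≈⟨ distribˡ b q (- q + y) ⟨
      b * (q + (- q + y))   ≈⟨ *-congˡ (+-assoc q (- q) y) ⟨
      b * ((q + - q) + y)   ≈⟨ *-congˡ (+-congʳ (-‿inverseʳ q)) ⟩
      b * (0# + y)          ≈⟨ *-congˡ (+-identityˡ y) ⟩
      b * y                 ∎

    k<n*y : a < b * y
    k<n*y = SPO.<-respʳ-≈ b*q+[b*[y-q]]≈b*y
      (SPO.<-respˡ-≈ (≈.trans (+-identityʳ (b * q)) b*q≈a)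
        (+-monoʳ-< (b * q) (*-pos (0<fromℕ-suc n) 0<y-q)))

  Within : Carrier → Carrier → Carrier → Set ℓ₂
  Within ε x y = x - ε < y × y < x + ε

  Limit : (ℕ → Carrier) → Carrier → Set (c ⊔ ℓ₂)
  Limit f x = ∀ ε → 0# < ε → ∃[ N ] ∀ n → N ℕ.≤ n → Within ε x (f n)

  -- Unordered summation: the finite partial sums converge to x along the
  -- directed set of finite subsets of A.
  HasSum : ∀ {A : Set} → (A → Carrier) → Carrier → Set (c ⊔ ℓ₂)
  HasSum {A} f x = ∀ ε → 0# < ε → ∃[ L₀ ] ∀ (L : List A) → Unique L → L₀ ⊆ L →
    Within ε x (List.foldr _+_ 0# (List.map f L))

  record IsFinDistribution {n} (p : Fin n → Carrier) : Set (c ⊔ ℓ₁ ⊔ ℓ₂) where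
    field
      nonNegative : ∀ i → 0# ≤ p i
      totalMass   : sum p ≈ 1#

  record IsDistribution {A : Set} (p : A → Carrier) : Set (c ⊔ ℓ₂) where
    field
      nonNegative : ∀ a → 0# ≤ p a
      totalMass   : HasSum p 1#

  -- Throughout, n = suc m.  An index i ∈ [n] is represented by an element of
  -- Fin (suc m) whose toℕ is i - 1, and likewise for [n - 1] and Fin m.

  -- σ_{≤ i}
  cdf : ∀ {n} → (Fin n → Carrier) → Fin n → Carrier
  cdf σ i = sum λ j → if does (j Fin.≤? i) then σ j else 0#

  State : ℕ → Set
  State m = Vec ℕ m

  -- d + e_{i-1}.  For i = 1 the result is irrelevant: the corresponding move
  -- has probability (i - 1) / i = 0.
  _+e[_-1] : ∀ {m} → State m → Fin (suc m) → State m
  d +e[ zero  -1] = d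
  d +e[ suc j -1] = updateAt d j suc

  data Step (m : ℕ) : Set where
    advance : Fin (suc m) → Step m
    branch  : (moved ended : State m) → Step m

  -- The case i = n implements the conventions d_n = ∞ and e_n = 0.
  step : ∀ {m} → State m → Fin (suc m) → Step m
  step d i with view i
  ... | ‵fromℕ = branch (d +e[ i -1]) d
  ... | ‵inject₁ j with lookup d j
  ...   | zero  = advance (suc j)
  ...   | suc k = branch ((d [ j ]≔ k) +e[ i -1]) (d [ j ]≔ k)

  indicator : ∀ {m} → State m → State m → Carrier
  indicator s t = if does (Vec.≡-dec ℕ._≟_ s t) then 1# else 0#

  -- Probability that, from the transitional state (d , i), the transition ends
  -- in t after at most k steps.
  endsWithin : ∀ {m} → ℕ → State m → Fin (suc m) → State m → Carrier
  endsWithin zero    d i t = 0#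
  endsWithin (suc k) d i t with step d i
  ... | advance i′         = endsWithin k d i′ t
  ... | branch moved ended =
          (toℕ i /ℕ suc (toℕ i)) * endsWithin k moved i t
        + (1 /ℕ suc (toℕ i)) * indicator ended t

  -- P s t is the probability that a transition started in s ends in t; by
  -- monotone continuity it is the limit of the probabilities of doing so
  -- within k steps.
  IsTransitionProbability : ∀ {m} → (Fin (suc m) → Carrier) →
    (State m → State m → Carrier) → Set (c ⊔ ℓ₂)
  IsTransitionProbability σ P = ∀ s t →
    Limit (λ k → sum λ i → σ i * endsWithin k s i t) (P s t)

  record IsStationary {m} (P : State m → State m → Carrier)
                      (π : State m → Carrier) : Set (c ⊔ ℓ₂) where
    field
      isDistribution : IsDistribution π
      invariant      : ∀ t → HasSum (λ s → π s * P s t) (π t)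

  Geom : Carrier → ℕ → Carrier
  Geom p k = (1# - p) ^ k * p

  ⨂ : ∀ {m} → (Fin m → ℕ → Carrier) → State m → Carrier
  ⨂ μ d = product λ i → μ i (lookup d i)

  -- ⨂_{i=1}^{n-1} Geom (1 - i / (n σ_{≤ i}))
  geometricProduct : ∀ {m} (σ : Fin (suc m) → Carrier) →
    (∀ (i : Fin m) → suc (toℕ i) /ℕ suc m < cdf σ (inject₁ i)) →
    State m → Carrier
  geometricProduct {m} σ i/n<σ≤i = ⨂ λ i → Geom
    (1# - fromℕ (suc (toℕ i)) / (fromℕ (suc m) * cdf σ (inject₁ i))
            [ /ℕ<⇒0<* (toℕ i) m (i/n<σ≤i i) ])

open Process ℝ-field public

{-# OPTIONS --safe #-}
module Submission where

-- When the initial state has law π, the expected number of visits to the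
-- transitional state (d , i) is σ_{≤ i} π(d): this solves the flow equations
-- because, with q_i = i / (n σ_{≤ i}), adding e_i multiplies π by q_i and
-- σ_{≤ i} q_i = i / n.  Ending from level i therefore contributes
-- σ_{≤ i} π(t + e_i) / i = π(t) / n to the probability of ending in t, and the n
-- levels together give π(t).
--
-- No limits are needed for this.  A transition lowers d_1 + … + d_{n-1} by at
-- most one, so t has only finitely many predecessors, and the probability of
-- ending in t within k steps is eventually constant in k.  All sums thus range
-- over boxes [0, N)^{n-1}, and the flow equations are tested against the
-- probability of ending in t.  The only genuine limit is the total mass of π:
-- the box has mass ∏ (1 - q_i^N) ≥ 1 - ∑ q_i^N.

open import Data.Bool.Base using (if_then_else_)
open import Data.Fin.Base using (Fin; zero; suc; toℕ; inject₁; fromℕ)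
open import Data.Fin.Induction using (>-weakInduction)
import Data.Fin.Properties as Fin
open import Data.Fin.Relation.Unary.Top using (View; view; view-fromℕ; view-inject₁; ‵fromℕ; ‵inject₁)
open import Data.List.Base as List using (List; []; _∷_; _++_; [_]; upTo; cartesianProductWith)
import Data.List.Properties as List
open import Data.List.Membership.Propositional using (_∈_; _∉_)
open import Data.List.Membership.Propositional.Properties using (∈-∃++; ∈-++⁺ʳ; ∈-upTo⁺; ∈-cartesianProductWith⁺)
open import Data.List.Relation.Binary.Permutation.Propositional as Perm using (_↭_; ↭-trans; ↭-sym; prep; ↭⇒↭ₛ)
open import Data.List.Relation.Binary.Permutation.Propositional.Properties using (shift; ∈-resp-↭)
import Data.List.Relation.Binary.Permutation.Setoid.Properties as Permₛ
open import Data.List.Relation.Binary.Subset.Propositional using (_⊆_)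
open import Data.List.Relation.Unary.All as All using ([]; _∷_)
open import Data.List.Relation.Unary.AllPairs using ([]; _∷_)
open import Data.List.Relation.Unary.Any using (here; there) renaming (tail to ∈-tail)
open import Data.List.Relation.Unary.Unique.Propositional using (Unique)
open import Data.List.Relation.Unary.Unique.Propositional.Properties using (cartesianProductWith⁺; upTo⁺)
open import Data.Nat.Base as ℕ using (ℕ; zero; suc)
import Data.Nat.Properties as ℕ
open import Data.Product.Base using (∃-syntax; _×_; _,_; proj₁; proj₂)
open import Data.Sum.Base using (_⊎_; inj₁; inj₂)
open import Data.Vec.Base as Vec using (Vec; []; _∷_; lookup; updateAt; _[_]≔_)
import Data.Vec.Properties as Vec
open import Function.Base using (_∘_)
open import Relation.Binary.PropositionalEquality.Core as ≡ using (_≡_; _≢_)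
open import Relation.Binary.PropositionalEquality.Properties using () renaming (setoid to ≡-setoid)
import Relation.Binary.Reasoning.Setoid as ≈-Reasoning
open import Relation.Binary.Structures using (IsStrictPartialOrder)
open import Relation.Nullary.Decidable.Core using (yes; no; does)
open import Relation.Nullary.Negation.Core using (¬_; contradiction)
open import Defs using (ArchimedeanOrderedField; module Process)

-- Finite lists, boxes and coordinate updates.

complement : ∀ {A : Set} (K L : List A) → Unique K → Unique L → K ⊆ L →
  ∃[ M ] (L ↭ K ++ M × (∀ {x} → x ∈ M → x ∉ K))
complement []      L _ _ _ = L , Perm.↭-refl , λ _ ()
-- Moving `x` to the front of `L` leaves `as ++ bs`, which by uniqueness no longer contains `x`. The
-- inductive remainder `M` is part of that list, so it avoids `x` as well as `K`.
complement (x ∷ K) L (x∉K ∷ K!) L! x∷K⊆L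
  with as , bs , ≡.refl ← ∈-∃++ (x∷K⊆L (here ≡.refl))
  with x∉L′ ∷ L′! ← Permₛ.Unique-resp-↭ (≡-setoid _) (↭⇒↭ₛ (shift x as bs)) L!
  with M , L′↭K++M , M∩K=∅ ← complement K (as ++ bs) K! L′!
         (λ y∈K → ∈-tail (All.lookup x∉K y∈K ∘ ≡.sym) (∈-resp-↭ (shift x as bs) (x∷K⊆L (there y∈K))))
  = M , ↭-trans (shift x as bs) (prep x L′↭K++M)
  , λ { y∈M (here ≡.refl) → All.lookup x∉L′ (∈-resp-↭ (↭-sym L′↭K++M) (∈-++⁺ʳ K y∈M)) ≡.refl
      ; y∈M (there y∈K)   → M∩K=∅ y∈M y∈K }

box : ℕ → (m : ℕ) → List (Vec ℕ m)
box N zero    = [ [] ]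
box N (suc m) = cartesianProductWith _∷_ (upTo N) (box N m)

box-unique : ∀ N m → Unique (box N m)
box-unique N zero    = [] ∷ []
box-unique N (suc m) = cartesianProductWith⁺ _∷_ Vec.∷-injective (upTo⁺ N) (box-unique N m)

sum<⇒∈box : ∀ {N m} (d : Vec ℕ m) → Vec.sum d ℕ.< N → d ∈ box N m
sum<⇒∈box []      _  = here ≡.refl
sum<⇒∈box (k ∷ d) lt = ∈-cartesianProductWith⁺ _∷_
  (∈-upTo⁺ (ℕ.≤-<-trans (ℕ.m≤m+n k (Vec.sum d)) lt))
  (sum<⇒∈box d (ℕ.≤-<-trans (ℕ.m≤n+m (Vec.sum d) k) lt))

lookup≤sum : ∀ {m} (d : Vec ℕ m) j → lookup d j ℕ.≤ Vec.sum d
lookup≤sum (k ∷ d) zero    = ℕ.m≤m+n k (Vec.sum d)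
lookup≤sum (k ∷ d) (suc j) = ℕ.≤-trans (lookup≤sum d j) (ℕ.m≤n+m (Vec.sum d) k)

sum-updateAt-suc : ∀ {m} (d : Vec ℕ m) j → Vec.sum (updateAt d j suc) ≡ suc (Vec.sum d)
sum-updateAt-suc (k ∷ d) zero    = ≡.refl
sum-updateAt-suc (k ∷ d) (suc j) =
  ≡.trans (≡.cong (k ℕ.+_) (sum-updateAt-suc d j)) (ℕ.+-suc k (Vec.sum d))

updateAt-suc-pred : ∀ {m} (d : Vec ℕ m) j {k} → lookup d j ≡ suc k → updateAt (d [ j ]≔ k) j suc ≡ d
updateAt-suc-pred (_ ∷ d) zero    ≡.refl = ≡.refl
updateAt-suc-pred (k ∷ d) (suc j) eq     = ≡.cong (k ∷_) (updateAt-suc-pred d j eq)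

updateAt-pred-suc : ∀ {m} (d : Vec ℕ m) j → updateAt d j suc [ j ]≔ lookup d j ≡ d
updateAt-pred-suc (_ ∷ d) zero    = ≡.refl
updateAt-pred-suc (k ∷ d) (suc j) = ≡.cong (k ∷_) (updateAt-pred-suc d j)

-- Order arithmetic in an Archimedean ordered field.

module OrderedField {c ℓ₁ ℓ₂} (F : ArchimedeanOrderedField c ℓ₁ ℓ₂) where

  open ArchimedeanOrderedField F hiding (zero) renaming (fromℕ to natural)
  open Process F using (0<fromℕ-suc; Within)
  open IsStrictPartialOrder <-isStrictPartialOrder public
    using (<-respˡ-≈; <-respʳ-≈) renaming (irrefl to <-irrefl; trans to <-trans)
  open import Algebra.Properties.Semiring.Exp semiring using (_^_)
  open import Algebra.Properties.CommutativeSemigroup *-commutativeSemigroup using (x∙yz≈y∙xz)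
  open import Algebra.Solver.Ring.NaturalCoefficients.Default commutativeSemiring using (solve; _:+_; _:*_; _:=_; con)
  open import Algebra.Properties.Semiring.Sum semiring using (sum)
  open import Algebra.Definitions.RawMonoid *-rawMonoid using () renaming (sum to product)
  open ≈-Reasoning setoid

  -- `x ≤ y` is only a negation, so no case analysis on the order is at hand; cotransitivity of
  -- `y < z` at `x` supplies the one needed.
  ≤-<-trans : ∀ {x y z} → x ≤ y → y < z → x < z
  ≤-<-trans {x} x≤y y<z with <-cotrans y<z x
  ... | inj₁ y<x = contradiction y<x x≤y
  ... | inj₂ x<z = x<z

  <-≤-trans : ∀ {x y z} → x < y → y ≤ z → x < z
  <-≤-trans {z = z} x<y y≤z with <-cotrans x<y z
  ... | inj₁ x<z = x<z
  ... | inj₂ z<y = contradiction z<y y≤z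

  ≤-trans : ∀ {x y z} → x ≤ y → y ≤ z → x ≤ z
  ≤-trans x≤y y≤z z<x = x≤y (≤-<-trans y≤z z<x)

  ≤-reflexive : ∀ {x y} → x ≈ y → x ≤ y
  ≤-reflexive x≈y = <-irrefl (sym x≈y)

  <⇒≤ : ∀ {x y} → x < y → x ≤ y
  <⇒≤ x<y y<x = <-irrefl refl (<-trans x<y y<x)

  ≤-respˡ-≈ : ∀ {x y z} → x ≈ y → x ≤ z → y ≤ z
  ≤-respˡ-≈ x≈y x≤z z<y = x≤z (<-respʳ-≈ (sym x≈y) z<y)

  ≤-respʳ-≈ : ∀ {x y z} → x ≈ y → z ≤ x → z ≤ y
  ≤-respʳ-≈ x≈y z≤x y<z = z≤x (<-respˡ-≈ (sym x≈y) y<z)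

  -x+[x+y]≈y : ∀ x y → - x + (x + y) ≈ y
  -x+[x+y]≈y x y = begin
    - x + (x + y) ≈⟨ +-assoc (- x) x y ⟨
    - x + x + y   ≈⟨ +-congʳ (-‿inverseˡ x) ⟩
    0# + y        ≈⟨ +-identityˡ y ⟩
    y             ∎

  x-y+y≈x : ∀ x y → x - y + y ≈ x
  x-y+y≈x x y = begin
    x - y + y     ≈⟨ +-assoc x (- y) y ⟩
    x + (- y + y) ≈⟨ +-congˡ (-‿inverseˡ y) ⟩
    x + 0#        ≈⟨ +-identityʳ x ⟩
    x             ∎

  x+y≈z⇒x≈z-y : ∀ {x y z} → x + y ≈ z → x ≈ z - y
  x+y≈z⇒x≈z-y {x} {y} {z} x+y≈z = begin
    x             ≈⟨ +-identityʳ x ⟨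
    x + 0#        ≈⟨ +-congˡ (-‿inverseʳ y) ⟨
    x + (y - y)   ≈⟨ +-assoc x y (- y) ⟨
    x + y - y     ≈⟨ +-congʳ x+y≈z ⟩
    z - y         ∎

  +-cancelˡ-< : ∀ z {x y} → z + x < z + y → x < y
  +-cancelˡ-< z z+x<z+y =
    <-respˡ-≈ (-x+[x+y]≈y z _) (<-respʳ-≈ (-x+[x+y]≈y z _) (+-monoʳ-< (- z) z+x<z+y))

  +-monoˡ-< : ∀ z {x y} → x < y → x + z < y + z
  +-monoˡ-< z x<y = <-respˡ-≈ (+-comm z _) (<-respʳ-≈ (+-comm z _) (+-monoʳ-< z x<y))

  +-monoʳ-≤ : ∀ z {x y} → x ≤ y → z + x ≤ z + y
  +-monoʳ-≤ z x≤y z+y<z+x = x≤y (+-cancelˡ-< z z+y<z+x)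

  +-monoˡ-≤ : ∀ z {x y} → x ≤ y → x + z ≤ y + z
  +-monoˡ-≤ z x≤y = ≤-respˡ-≈ (+-comm z _) (≤-respʳ-≈ (+-comm z _) (+-monoʳ-≤ z x≤y))

  +-mono-< : ∀ {w x y z} → w < x → y < z → w + y < x + z
  +-mono-< w<x y<z = <-trans (+-monoˡ-< _ w<x) (+-monoʳ-< _ y<z)

  0<x-y : ∀ {x y} → y < x → 0# < x - y
  0<x-y {y = y} y<x = <-respˡ-≈ (-‿inverseʳ y) (+-monoˡ-< (- y) y<x)

  x≤x+y : ∀ {x y} → 0# ≤ y → x ≤ x + y
  x≤x+y {x} 0≤y = ≤-respˡ-≈ (+-identityʳ x) (+-monoʳ-≤ x 0≤y)

  x<x+y : ∀ {x y} → 0# < y → x < x + y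
  x<x+y {x} 0<y = <-respˡ-≈ (+-identityʳ x) (+-monoʳ-< x 0<y)

  x<y+z⇒x-z<y : ∀ {x y z} → x < y + z → x - z < y
  x<y+z⇒x-z<y {z = z} x<y+z =
    <-respʳ-≈ (sym (x+y≈z⇒x≈z-y refl)) (+-monoˡ-< (- z) x<y+z)

  +-nonNegative : ∀ {x y} → 0# ≤ x → 0# ≤ y → 0# ≤ x + y
  +-nonNegative 0≤x 0≤y = ≤-trans 0≤x (x≤x+y 0≤y)

  -- The goal is a negation, so a negative product may be assumed. A positive `x` would exclude a
  -- positive `y`, making `y` zero by `<-tight`; so `x` is not positive either and is itself zero.
  -- Both times the product is zero, hence not negative.
  *-nonNegative : ∀ {x y} → 0# ≤ x → 0# ≤ y → 0# ≤ x * y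
  *-nonNegative {x} {y} 0≤x 0≤y xy<0 = <-irrefl (trans (*-congʳ x≈0) (zeroˡ y)) xy<0
    where
    0≮x : ¬ 0# < x
    0≮x 0<x = <-irrefl (trans (*-congˡ (<-tight 0≤y λ 0<y → <⇒≤ (*-pos 0<x 0<y) xy<0)) (zeroʳ x)) xy<0
    x≈0 : x ≈ 0#
    x≈0 = <-tight 0≤x 0≮x

  *-monoˡ-< : ∀ z {x y} → 0# < z → x < y → z * x < z * y
  *-monoˡ-< z {x} {y} 0<z x<y =
    <-respʳ-≈ (trans (sym (distribˡ z x (y - x))) (*-congˡ (trans (+-comm x _) (x-y+y≈x y x))))
      (x<x+y (*-pos 0<z (0<x-y x<y)))

  *-monoˡ-≤ : ∀ z {x y} → 0# ≤ z → x ≤ y → z * x ≤ z * y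
  *-monoˡ-≤ z {x} {y} 0≤z x≤y =
    ≤-respʳ-≈ (trans (sym (distribˡ z x (y - x))) (*-congˡ (trans (+-comm x _) (x-y+y≈x y x))))
      (x≤x+y (*-nonNegative 0≤z (≤-respˡ-≈ (-‿inverseʳ x) (+-monoˡ-≤ (- x) x≤y))))

  0<x+y⇒0<x⊎0<y : ∀ {x y} → 0# < x + y → 0# < x ⊎ 0# < y
  0<x+y⇒0<x⊎0<y {x} 0<x+y with <-cotrans 0<x+y x
  ... | inj₁ 0<x   = inj₁ 0<x
  ... | inj₂ x<x+y = inj₂ (+-cancelˡ-< x (<-respˡ-≈ (sym (+-identityʳ x)) x<x+y))

  -- The product is a sum of `n` copies of `x`, and cotransitivity finds a positive one among them.
  0<natural*⇒0< : ∀ n {x} → 0# < natural n * x → 0# < x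
  0<natural*⇒0< zero    {x} 0<0*x  = contradiction 0<0*x (<-irrefl (sym (zeroˡ x)))
  0<natural*⇒0< (suc n) {x} 0<sn*x
    with 0<x+y⇒0<x⊎0<y (<-respʳ-≈ (trans (distribʳ x 1# (natural n)) (+-congʳ (*-identityˡ x))) 0<sn*x)
  ... | inj₁ 0<x   = 0<x
  ... | inj₂ 0<n*x = 0<natural*⇒0< n 0<n*x

  -- Compare n x⁻¹ with 0 and 1 for a natural n > x: were n x⁻¹ < 1, multiplying
  -- by x would give n < x.
  recip-pos : ∀ x (0<x : 0# < x) → 0# < recip x 0<x
  recip-pos x 0<x with n , x<n ← archimedean x with <-cotrans 0<1 (natural n * recip x 0<x)
  ... | inj₁ 0<n/x = 0<natural*⇒0< n 0<n/x
  ... | inj₂ n/x<1 = contradiction (<-respˡ-≈ x*[n/x]≈n (<-respʳ-≈ (*-identityʳ x) (*-monoˡ-< x 0<x n/x<1))) (<⇒≤ x<n)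
    where
    x*[n/x]≈n : x * (natural n * recip x 0<x) ≈ natural n
    x*[n/x]≈n = trans (x∙yz≈y∙xz x _ _) (trans (*-congˡ (*-recip x 0<x)) (*-identityʳ _))

  *-cancelˡ-< : ∀ z {x y} → 0# < z → z * x < z * y → x < y
  *-cancelˡ-< z 0<z z*x<z*y =
    <-respˡ-≈ (cancel _) (<-respʳ-≈ (cancel _) (*-monoˡ-< _ (recip-pos z 0<z) z*x<z*y))
    where
    cancel : ∀ x → recip z 0<z * (z * x) ≈ x
    cancel x = trans (sym (*-assoc _ z x)) (trans (*-congʳ (trans (*-comm _ z) (*-recip z 0<z))) (*-identityˡ x))

  natural-mono-≤ : ∀ {m n} → m ℕ.≤ n → natural m ≤ natural n
  natural-mono-≤ {n = zero}  ℕ.z≤n       = ≤-reflexive refl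
  natural-mono-≤ {n = suc n} ℕ.z≤n       = <⇒≤ (0<fromℕ-suc n)
  natural-mono-≤             (ℕ.s≤s m≤n) = +-monoʳ-≤ 1# (natural-mono-≤ m≤n)

  -- Decay of powers, and products of numbers close to one.

  ^-pos : ∀ {x} → 0# < x → ∀ n → 0# < x ^ n
  ^-pos 0<x zero    = 0<1
  ^-pos 0<x (suc n) = *-pos 0<x (^-pos 0<x n)

  product-pos : ∀ {n} (x : Fin n → Carrier) → (∀ i → 0# < x i) → 0# < product x
  product-pos {zero}  x 0<x = 0<1
  product-pos {suc n} x 0<x = *-pos (0<x zero) (product-pos (x ∘ suc) (0<x ∘ suc))

  x+y≈1⇒x≤1 : ∀ {x y} → x + y ≈ 1# → 0# ≤ y → x ≤ 1#
  x+y≈1⇒x≤1 x+y≈1 0≤y = ≤-respʳ-≈ x+y≈1 (x≤x+y 0≤y)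

  -- Bernoulli's inequality, free of division. The left side starts at 1 and does not increase with
  -- n, because q (1 + (n + 1) p) = 1 + n p - (n + 1) p p.
  bernoulli : ∀ {p q} → q + p ≈ 1# → 0# < q → 0# < p →
    ∀ n → q ^ n * (1# + natural n * p) ≤ 1#
  bernoulli {p} {q} q+p≈1 0<q 0<p zero    = ≤-reflexive (solve 1 (λ p → con 1 :* (con 1 :+ con 0 :* p) := con 1) refl p)
  bernoulli {p} {q} q+p≈1 0<q 0<p (suc n) = ≤-trans
    (≤-respˡ-≈ (solve 3 (λ q x y → x :* (q :* y) := q :* x :* y) refl q (q ^ n) _)
      (*-monoˡ-≤ (q ^ n) (<⇒≤ (^-pos 0<q n)) (≤-respʳ-≈ expand (x≤x+y 0≤rest))))
    (bernoulli q+p≈1 0<q 0<p n)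
    where
    0≤n : 0# ≤ natural n
    0≤n = natural-mono-≤ {n = n} ℕ.z≤n
    rest = p * p + natural n * (p * p)
    0≤rest : 0# ≤ rest
    0≤rest = +-nonNegative (<⇒≤ (*-pos 0<p 0<p)) (*-nonNegative 0≤n (<⇒≤ (*-pos 0<p 0<p)))
    expand : q * (1# + (1# + natural n) * p) + rest ≈ 1# + natural n * p
    expand = begin
      q * (1# + (1# + natural n) * p) + rest
        ≈⟨ solve 3 (λ q p n → q :* (con 1 :+ (con 1 :+ n) :* p) :+ (p :* p :+ n :* (p :* p))
                            := q :+ (q :+ p) :* p :+ (q :+ p) :* (n :* p)) refl q p (natural n) ⟩
      q + (q + p) * p + (q + p) * (natural n * p)
        ≈⟨ +-cong (+-congˡ (trans (*-congʳ q+p≈1) (*-identityˡ p))) (trans (*-congʳ q+p≈1) (*-identityˡ _)) ⟩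
      q + p + natural n * p
        ≈⟨ +-congʳ q+p≈1 ⟩
      1# + natural n * p ∎

  ^-vanishes : ∀ {p q} → q + p ≈ 1# → 0# < q → 0# < p →
    ∀ ε → 0# < ε → ∃[ N ] ∀ n → N ℕ.≤ n → q ^ n < ε
  ^-vanishes {p} {q} q+p≈1 0<q 0<p ε 0<ε = N , λ n N≤n → close n (<-≤-trans r<N (natural-mono-≤ N≤n))
    where
    -- Any natural n above 1 / (p ε) works: n p q^n ≤ q^n (1 + n p) ≤ 1 < n p ε, and the positive
    -- factor n p cancels.
    0<pε = *-pos 0<p 0<ε
    r    = recip (p * ε) 0<pε
    N    = proj₁ (archimedean r)
    r<N  = proj₂ (archimedean r)
    close : ∀ n → r < natural n → q ^ n < ε
    close n r<n = *-cancelˡ-< (natural n * p) (*-pos (<-trans (recip-pos _ 0<pε) r<n) 0<p)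
      (≤-<-trans (≤-trans below (bernoulli q+p≈1 0<q 0<p n)) 1<)
      where
      below : natural n * p * q ^ n ≤ q ^ n * (1# + natural n * p)
      below = ≤-respʳ-≈ (solve 2 (λ x y → y :* x :+ x := x :* (con 1 :+ y)) refl (q ^ n) (natural n * p))
        (x≤x+y (<⇒≤ (^-pos 0<q n)))
      1< : 1# < natural n * p * ε
      1< = <-respˡ-≈ (*-recip _ 0<pε)
        (<-respʳ-≈ (solve 3 (λ p e n → p :* e :* n := n :* p :* e) refl p ε (natural n))
          (*-monoˡ-< (p * ε) 0<pε r<n))

  halve : ∀ ε → 0# < ε → ∃[ δ ] 0# < δ × δ + δ ≈ ε
  halve ε 0<ε = ε * h , *-pos 0<ε (recip-pos _ 0<2) , (begin
    ε * h + ε * h       ≈⟨ solve 2 (λ e h → e :* h :+ e :* h := e :* ((con 1 :+ (con 1 :+ con 0)) :* h)) refl ε h ⟩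
    ε * (natural 2 * h) ≈⟨ *-congˡ (*-recip _ 0<2) ⟩
    ε * 1#              ≈⟨ *-identityʳ ε ⟩
    ε                   ∎)
    where
    0<2 = 0<fromℕ-suc 1
    h   = recip (natural 2) 0<2

  sum-vanishes : ∀ {m} (x : Fin m → ℕ → Carrier) →
    (∀ i ε → 0# < ε → ∃[ N ] ∀ n → N ℕ.≤ n → x i n < ε) →
    ∀ ε → 0# < ε → ∃[ N ] ∀ n → N ℕ.≤ n → sum (λ i → x i n) < ε
  sum-vanishes {zero}  x x→0 ε 0<ε = 0 , λ _ _ → 0<ε
  sum-vanishes {suc m} x x→0 ε 0<ε =
    let δ , 0<δ , δ+δ≈ε = halve ε 0<ε
        M , small       = x→0 zero δ 0<δ
        N , smalls      = sum-vanishes (x ∘ suc) (x→0 ∘ suc) δ 0<δ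
    in M ℕ.⊔ N , λ n le → <-respʳ-≈ δ+δ≈ε
         (+-mono-< (small n (ℕ.m⊔n≤o⇒m≤o M N le)) (smalls n (ℕ.m⊔n≤o⇒n≤o M N le)))

  -- The bound ∏ (1 - x_i) ≥ 1 - ∑ x_i in subtraction-free form. The estimate `product y ≤ 1#` is
  -- carried along because the induction step replaces `x₀ * ∏` by `x₀`.
  product-complements : ∀ {m} (x y : Fin m → Carrier) → (∀ i → y i + x i ≈ 1#) →
    (∀ i → 0# ≤ x i) → (∀ i → 0# ≤ y i) →
    0# ≤ product y × product y ≤ 1# × 1# ≤ product y + sum x
  product-complements {zero} x y _ _ _ = <⇒≤ 0<1 , ≤-reflexive refl , x≤x+y (≤-reflexive refl)
  product-complements {suc m} x y y+x≈1 0≤x 0≤y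
    with 0≤∏ , ∏≤1 , 1≤∏+∑ ← product-complements (x ∘ suc) (y ∘ suc) (y+x≈1 ∘ suc) (0≤x ∘ suc) (0≤y ∘ suc)
    = *-nonNegative (0≤y zero) 0≤∏
    , ≤-trans (≤-respʳ-≈ (*-identityʳ y₀) (*-monoˡ-≤ y₀ (0≤y zero) ∏≤1)) (x+y≈1⇒x≤1 (y+x≈1 zero) (0≤x zero))
    , ≤-trans 1≤∏+∑ (≤-trans
        (≤-respˡ-≈ regroup (+-monoʳ-≤ (y₀ * ∏ + ∑) (*-monoˡ-≤ x₀ (0≤x zero) ∏≤1)))
        (≤-reflexive (solve 3 (λ a b c → a :+ c :+ b :* con 1 := a :+ (b :+ c)) refl (y₀ * ∏) x₀ ∑)))
    where
    x₀ = x zero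
    y₀ = y zero
    ∏  = product (y ∘ suc)
    ∑  = sum (x ∘ suc)
    regroup : y₀ * ∏ + ∑ + x₀ * ∏ ≈ ∏ + ∑
    regroup = begin
      y₀ * ∏ + ∑ + x₀ * ∏ ≈⟨ solve 4 (λ y x p s → y :* p :+ s :+ x :* p := (y :+ x) :* p :+ s) refl y₀ x₀ ∏ ∑ ⟩
      (y₀ + x₀) * ∏ + ∑   ≈⟨ +-congʳ (trans (*-congʳ (y+x≈1 zero)) (*-identityˡ ∏)) ⟩
      ∏ + ∑               ∎

  ≈⇒Within : ∀ {x y ε} → 0# < ε → x ≈ y → Within ε x y
  ≈⇒Within 0<ε x≈y =
    x<y+z⇒x-z<y (<-respˡ-≈ (sym x≈y) (x<x+y 0<ε)) , <-respˡ-≈ x≈y (x<x+y 0<ε)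

  -- Conservation along a chain of levels: each level receives its `Q` afresh and the `X` of the
  -- level below, passes on its own `X` and loses `v`. The extra inflow `r` into the first level
  -- serves the induction, where it becomes `X zero`.
  telescope : ∀ {m} (Q X : Fin (suc m) → Carrier) {v r} →
    Q zero + r ≈ X zero + v → (∀ j → Q (suc j) + X (inject₁ j) ≈ X (suc j) + v) →
    sum Q + r ≈ X (fromℕ m) + natural (suc m) * v
  telescope {zero} Q X {v} {r} start next = begin
    Q zero + 0# + r           ≈⟨ +-congʳ (+-identityʳ _) ⟩
    Q zero + r                ≈⟨ start ⟩
    X zero + v                ≈⟨ solve 2 (λ x v → x :+ v := x :+ (con 1 :+ con 0) :* v) refl (X zero) v ⟩
    X zero + natural 1 * v    ∎
  telescope {suc m} Q X {v} {r} start next = begin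
    Q zero + sum (Q ∘ suc) + r                        ≈⟨ solve 3 (λ a b c → a :+ b :+ c := a :+ c :+ b) refl _ _ r ⟩
    Q zero + r + sum (Q ∘ suc)                        ≈⟨ +-congʳ start ⟩
    X zero + v + sum (Q ∘ suc)                        ≈⟨ solve 3 (λ a b c → a :+ b :+ c := c :+ a :+ b) refl _ v _ ⟩
    sum (Q ∘ suc) + X zero + v                        ≈⟨ +-congʳ (telescope (Q ∘ suc) (X ∘ suc) (next zero) (next ∘ suc)) ⟩
    X (fromℕ (suc m)) + natural (suc m) * v + v       ≈⟨ solve 3 (λ x n v → x :+ n :* v :+ v := x :+ (con 1 :+ n) :* v) refl _ (natural (suc m)) v ⟩
    X (fromℕ (suc m)) + natural (suc (suc m)) * v     ∎

-- Sums over finite lists.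

module ListSum {c ℓ₁ ℓ₂} (F : ArchimedeanOrderedField c ℓ₁ ℓ₂) where

  open ArchimedeanOrderedField F hiding (zero)
  open Process F using (HasSum; ⨂)
  open OrderedField F
  open import Algebra.Properties.Semiring.Exp semiring using (_^_)
  open import Algebra.Solver.Ring.NaturalCoefficients.Default commutativeSemiring using (solve; _:+_; _:*_; _:=_; con)
  open import Algebra.Properties.Semiring.Sum semiring using (sum)
  open import Algebra.Definitions.RawMonoid *-rawMonoid using () renaming (sum to product)
  open ≈-Reasoning setoid

  listSum : ∀ {A : Set} → (A → Carrier) → List A → Carrier
  listSum f L = List.foldr _+_ 0# (List.map f L)

  private variable
    A B C : Set

  listSum-cong : ∀ {f g : A → Carrier} (L : List A) → (∀ x → f x ≈ g x) → listSum f L ≈ listSum g L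
  listSum-cong []      f≈g = refl
  listSum-cong (x ∷ L) f≈g = +-cong (f≈g x) (listSum-cong L f≈g)

  listSum-zero : ∀ {f : A → Carrier} (L : List A) → (∀ {x} → x ∈ L → f x ≈ 0#) → listSum f L ≈ 0#
  listSum-zero []      f≈0 = refl
  listSum-zero (x ∷ L) f≈0 = trans (+-cong (f≈0 (here ≡.refl)) (listSum-zero L (f≈0 ∘ there))) (+-identityˡ 0#)

  listSum-nonNegative : ∀ {f : A → Carrier} (L : List A) → (∀ x → 0# ≤ f x) → 0# ≤ listSum f L
  listSum-nonNegative []      0≤f = ≤-reflexive refl
  listSum-nonNegative (x ∷ L) 0≤f = +-nonNegative (0≤f x) (listSum-nonNegative L 0≤f)

  listSum-+ : ∀ (f g : A → Carrier) L → listSum (λ x → f x + g x) L ≈ listSum f L + listSum g L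
  listSum-+ f g []      = sym (+-identityˡ 0#)
  listSum-+ f g (x ∷ L) = trans (+-congˡ (listSum-+ f g L))
    (solve 4 (λ a b c d → a :+ b :+ (c :+ d) := a :+ c :+ (b :+ d)) refl (f x) (g x) _ _)

  listSum-*ˡ : ∀ a (f : A → Carrier) L → listSum (λ x → a * f x) L ≈ a * listSum f L
  listSum-*ˡ a f []      = sym (zeroʳ a)
  listSum-*ˡ a f (x ∷ L) = trans (+-congˡ (listSum-*ˡ a f L)) (sym (distribˡ a (f x) _))

  listSum-*ʳ : ∀ a (f : A → Carrier) L → listSum (λ x → f x * a) L ≈ listSum f L * a
  listSum-*ʳ a f L = trans (listSum-cong L (λ x → *-comm (f x) a)) (trans (listSum-*ˡ a f L) (*-comm a _))

  listSum-++ : ∀ (f : A → Carrier) K L → listSum f (K ++ L) ≈ listSum f K + listSum f L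
  listSum-++ f []      L = sym (+-identityˡ _)
  listSum-++ f (x ∷ K) L = trans (+-congˡ (listSum-++ f K L)) (sym (+-assoc _ _ _))

  listSum-sum : ∀ {n} (f : A → Fin n → Carrier) L →
    listSum (λ x → sum (f x)) L ≈ sum (λ i → listSum (λ x → f x i) L)
  listSum-sum {n = zero}  f L = listSum-zero L λ _ → refl
  listSum-sum {n = suc n} f L =
    trans (listSum-+ (λ x → f x zero) _ L) (+-congˡ (listSum-sum (λ x → f x ∘ suc) L))

  listSum-↭ : ∀ (f : A → Carrier) {K L} → K ↭ L → listSum f K ≈ listSum f L
  listSum-↭ f Perm.refl         = refl
  listSum-↭ f (Perm.prep x p)   = +-congˡ (listSum-↭ f p)
  listSum-↭ f (Perm.swap x y p) = trans (+-congˡ (+-congˡ (listSum-↭ f p)))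
    (solve 3 (λ a b c → a :+ (b :+ c) := b :+ (a :+ c)) refl (f x) (f y) _)
  listSum-↭ f (Perm.trans p q)  = trans (listSum-↭ f p) (listSum-↭ f q)

  listSum-cartesianProductWith : ∀ (f : C → Carrier) (g : A → B → C) K L →
    listSum f (cartesianProductWith g K L) ≈ listSum (λ x → listSum (λ y → f (g x y)) L) K
  listSum-cartesianProductWith f g []      L = refl
  listSum-cartesianProductWith f g (x ∷ K) L = trans (listSum-++ f (List.map (g x) L) _)
    (+-cong (reflexive (≡.cong (List.foldr _+_ 0#) (≡.sym (List.map-∘ L)))) (listSum-cartesianProductWith f g K L))

  listSum-⊆-≈ : ∀ {f : A → Carrier} {K L} → Unique K → Unique L → K ⊆ L →
    (∀ x → x ∉ K → f x ≈ 0#) → listSum f K ≈ listSum f L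
  listSum-⊆-≈ {f = f} {K} {L} K! L! K⊆L f≈0
    with M , L↭K++M , M∩K=∅ ← complement K L K! L! K⊆L = sym (begin
      listSum f L               ≈⟨ listSum-↭ f L↭K++M ⟩
      listSum f (K ++ M)        ≈⟨ listSum-++ f K M ⟩
      listSum f K + listSum f M ≈⟨ +-congˡ (listSum-zero M λ x∈M → f≈0 _ (M∩K=∅ x∈M)) ⟩
      listSum f K + 0#          ≈⟨ +-identityʳ _ ⟩
      listSum f K               ∎)

  listSum-⊆-≤ : ∀ {f : A → Carrier} {K L} → Unique K → Unique L → K ⊆ L →
    (∀ x → 0# ≤ f x) → listSum f K ≤ listSum f L
  listSum-⊆-≤ {f = f} {K} {L} K! L! K⊆L 0≤f
    with M , L↭K++M , _ ← complement K L K! L! K⊆L =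
      ≤-respʳ-≈ (sym (trans (listSum-↭ f L↭K++M) (listSum-++ f K M))) (x≤x+y (listSum-nonNegative M 0≤f))

  -- No limit is involved: the summand vanishes outside `K`, so every list of distinct elements
  -- containing `K` already has sum `x`.
  finite-HasSum : ∀ {f : A → Carrier} {K x} → Unique K → (∀ y → y ∉ K → f y ≈ 0#) →
    listSum f K ≈ x → HasSum f x
  finite-HasSum {K = K} K! f≈0 ∑f≈x ε 0<ε = K , λ L L! K⊆L →
    ≈⇒Within 0<ε (trans (sym ∑f≈x) (listSum-⊆-≈ K! L! K⊆L f≈0))

  listSum-upTo-suc : ∀ (f : ℕ → Carrier) N → listSum f (upTo (suc N)) ≈ f 0 + listSum (f ∘ suc) (upTo N)
  listSum-upTo-suc f N = +-congˡ (reflexive (≡.cong (List.foldr _+_ 0#)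
    (≡.trans (List.map-applyUpTo suc f N) (≡.sym (List.map-upTo (f ∘ suc) N)))))

  listSum-upTo-∷ʳ : ∀ (f : ℕ → Carrier) N → listSum f (upTo (suc N)) ≈ listSum f (upTo N) + f N
  listSum-upTo-∷ʳ f N = trans (reflexive (≡.cong (listSum f) (≡.sym (List.upTo-∷ʳ N))))
    (trans (listSum-++ f (upTo N) [ N ]) (+-congˡ (+-identityʳ (f N))))

  -- The indicator of zero as a weight: it singles out the states with an empty gap while the sum
  -- still ranges over a whole box.
  δ₀ : ℕ → Carrier
  δ₀ zero    = 1#
  δ₀ (suc _) = 0#

  -- The shift turns 0, ..., N - 1 into 1, ..., N. Since `f N` vanishes, the positive indices can
  -- again be summed over `upTo N`.
  upTo-split : ∀ N (f : ℕ → Carrier) → f N ≈ 0# →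
    listSum f (upTo N) ≈ listSum (λ k → δ₀ k * f k) (upTo N) + listSum (f ∘ suc) (upTo N)
  upTo-split zero    f fN≈0 = sym (+-identityˡ 0#)
  upTo-split (suc N) f fN≈0 = begin
    listSum f (upTo (suc N))                   ≈⟨ listSum-upTo-suc f N ⟩
    f 0 + listSum (f ∘ suc) (upTo N)           ≈⟨ +-cong δ-part tail-part ⟨
    listSum (λ k → δ₀ k * f k) (upTo (suc N)) + listSum (f ∘ suc) (upTo (suc N)) ∎
    where
    δ-part : listSum (λ k → δ₀ k * f k) (upTo (suc N)) ≈ f 0
    δ-part = begin
      listSum (λ k → δ₀ k * f k) (upTo (suc N))              ≈⟨ listSum-upTo-suc (λ k → δ₀ k * f k) N ⟩
      1# * f 0 + listSum (λ k → 0# * f (suc k)) (upTo N)     ≈⟨ +-cong (*-identityˡ _) (listSum-zero (upTo N) λ _ → zeroˡ _) ⟩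
      f 0 + 0#                                               ≈⟨ +-identityʳ _ ⟩
      f 0                                                    ∎
    tail-part : listSum (f ∘ suc) (upTo (suc N)) ≈ listSum (f ∘ suc) (upTo N)
    tail-part = trans (listSum-upTo-∷ʳ (f ∘ suc) N) (trans (+-congˡ fN≈0) (+-identityʳ _))

  -- Sums over boxes, and the geometric series.

  boxSum : ∀ N {m} → (Vec ℕ m → Carrier) → Carrier
  boxSum N {m} f = listSum f (box N m)

  boxSum-∷ : ∀ N {m} (f : Vec ℕ (suc m) → Carrier) →
    boxSum N f ≈ listSum (λ k → boxSum N (λ d → f (k ∷ d))) (upTo N)
  boxSum-∷ N {m} f = listSum-cartesianProductWith f _∷_ (upTo N) (box N m)

  -- This mirrors the case distinction of `step`: either coordinate `j` is zero, or the state is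
  -- `updateAt d j suc` for a unique `d`. The vanishing hypothesis discards the states that the
  -- shift pushes out of the box.
  boxSum-split : ∀ N {m} (j : Fin m) (f : Vec ℕ m → Carrier) → (∀ d → N ℕ.≤ lookup d j → f d ≈ 0#) →
    boxSum N f ≈ boxSum N (λ d → δ₀ (lookup d j) * f d) + boxSum N (λ d → f (updateAt d j suc))
  boxSum-split N {suc m} zero f f≈0 = begin
    boxSum N f
      ≈⟨ boxSum-∷ N f ⟩
    listSum H (upTo N)
      ≈⟨ upTo-split N H (listSum-zero (box N m) λ _ → f≈0 _ ℕ.≤-refl) ⟩
    listSum (λ k → δ₀ k * H k) (upTo N) + listSum (H ∘ suc) (upTo N)
      ≈⟨ +-cong
           (trans (boxSum-∷ N _) (listSum-cong (upTo N) λ k → listSum-*ˡ (δ₀ k) (λ d → f (k ∷ d)) (box N m)))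
           (boxSum-∷ N _) ⟨
    boxSum N (λ d → δ₀ (lookup d zero) * f d) + boxSum N (λ d → f (updateAt d zero suc)) ∎
    where H = λ k → boxSum N (λ d → f (k ∷ d))
  boxSum-split N {suc m} (suc j) f f≈0 = begin
    boxSum N f
      ≈⟨ boxSum-∷ N f ⟩
    listSum (λ k → boxSum N (λ d → f (k ∷ d))) (upTo N)
      ≈⟨ listSum-cong (upTo N) (λ k → boxSum-split N j (λ d → f (k ∷ d)) (λ d → f≈0 (k ∷ d))) ⟩
    listSum (λ k → boxSum N (λ d → δ₀ (lookup d j) * f (k ∷ d)) + boxSum N (λ d → f (k ∷ updateAt d j suc))) (upTo N)
      ≈⟨ listSum-+ _ _ (upTo N) ⟩
    listSum (λ k → boxSum N (λ d → δ₀ (lookup d j) * f (k ∷ d))) (upTo N)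
      + listSum (λ k → boxSum N (λ d → f (k ∷ updateAt d j suc))) (upTo N)
      ≈⟨ +-cong (boxSum-∷ N _) (boxSum-∷ N _) ⟨
    boxSum N (λ d → δ₀ (lookup d (suc j)) * f d) + boxSum N (λ d → f (updateAt d (suc j) suc)) ∎

  boxSum-⨂ : ∀ N {m} (μ : Fin m → ℕ → Carrier) →
    boxSum N (⨂ μ) ≈ product (λ i → listSum (μ i) (upTo N))
  boxSum-⨂ N {zero}  μ = +-identityʳ 1#
  boxSum-⨂ N {suc m} μ = begin
    boxSum N (⨂ μ)
      ≈⟨ boxSum-∷ N (⨂ μ) ⟩
    listSum (λ k → boxSum N (λ d → μ zero k * ⨂ (μ ∘ suc) d)) (upTo N)
      ≈⟨ listSum-cong (upTo N) (λ k → trans (listSum-*ˡ (μ zero k) (⨂ (μ ∘ suc)) (box N m)) (*-congˡ (boxSum-⨂ N (μ ∘ suc)))) ⟩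
    listSum (λ k → μ zero k * product (λ i → listSum (μ (suc i)) (upTo N))) (upTo N)
      ≈⟨ listSum-*ʳ _ (μ zero) (upTo N) ⟩
    product (λ i → listSum (μ i) (upTo N)) ∎

  geometric-series : ∀ {p q} → q + p ≈ 1# → ∀ N → listSum (λ k → q ^ k * p) (upTo N) + q ^ N ≈ 1#
  geometric-series {p} {q} q+p≈1 zero    = +-identityˡ 1#
  geometric-series {p} {q} q+p≈1 (suc N) = begin
    listSum (λ k → q ^ k * p) (upTo (suc N)) + q * q ^ N
      ≈⟨ +-congʳ (listSum-upTo-suc (λ k → q ^ k * p) N) ⟩
    1# * p + listSum (λ k → q * q ^ k * p) (upTo N) + q * q ^ N
      ≈⟨ +-congʳ (+-congˡ (trans (listSum-cong (upTo N) λ k → *-assoc q (q ^ k) p) (listSum-*ˡ q _ (upTo N)))) ⟩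
    1# * p + q * S + q * q ^ N
      ≈⟨ solve 4 (λ p q s x → con 1 :* p :+ q :* s :+ q :* x := q :* (s :+ x) :+ p) refl p q S (q ^ N) ⟩
    q * (S + q ^ N) + p
      ≈⟨ +-congʳ (trans (*-congˡ (geometric-series q+p≈1 N)) (*-identityʳ q)) ⟩
    q + p
      ≈⟨ q+p≈1 ⟩
    1# ∎
    where S = listSum (λ k → q ^ k * p) (upTo N)

-- Finite-step transition probabilities.

module Transition {c ℓ₁ ℓ₂} (F : ArchimedeanOrderedField c ℓ₁ ℓ₂) where

  open ArchimedeanOrderedField F hiding (zero; fromℕ)
  open Process F
  open OrderedField F
  open ListSum F
  open import Algebra.Properties.Semiring.Sum semiring using (sum; sum-cong-≋; sum-replicate-zero)
  open import Algebra.Solver.Ring.NaturalCoefficients.Default commutativeSemiring using (solve; _:*_; _:=_)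
  open ≈-Reasoning setoid

  private variable
    m : ℕ

  continue end : Fin m → Carrier
  continue i = toℕ i /ℕ suc (toℕ i)
  end      i = 1 /ℕ suc (toℕ i)

  step-last : ∀ (d : State m) → step d (fromℕ m) ≡ branch (d +e[ fromℕ m -1]) d
  step-last {m} d rewrite view-fromℕ m = ≡.refl

  step-empty : ∀ (d : State m) j → lookup d j ≡ 0 → step d (inject₁ j) ≡ advance (suc j)
  step-empty d j eq rewrite view-inject₁ j | eq = ≡.refl

  step-nonempty : ∀ (d : State m) j {k} → lookup d j ≡ suc k →
    step d (inject₁ j) ≡ branch ((d [ j ]≔ k) +e[ inject₁ j -1]) (d [ j ]≔ k)
  step-nonempty d j eq rewrite view-inject₁ j | eq = ≡.refl

  endsWithin-advance : ∀ k (d : State m) i t {i′} → step d i ≡ advance i′ →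
    endsWithin (suc k) d i t ≡ endsWithin k d i′ t
  endsWithin-advance k d i t eq rewrite eq = ≡.refl

  endsWithin-branch : ∀ k (d : State m) i t {moved ended} → step d i ≡ branch moved ended →
    endsWithin (suc k) d i t ≡ continue i * endsWithin k moved i t + end i * indicator ended t
  endsWithin-branch k d i t eq rewrite eq = ≡.refl

  indicator-refl : ∀ (t : State m) → indicator t t ≈ 1#
  indicator-refl t with Vec.≡-dec ℕ._≟_ t t
  ... | yes _  = refl
  ... | no t≢t = contradiction ≡.refl t≢t

  indicator-≢ : ∀ (s t : State m) → s ≢ t → indicator s t ≈ 0#
  indicator-≢ s t s≢t with Vec.≡-dec ℕ._≟_ s t
  ... | yes s≡t = contradiction s≡t s≢t
  ... | no _    = refl

  boxSum-indicator : ∀ {N} (f : State m → Carrier) t → Vec.sum t ℕ.< N →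
    boxSum N (λ d → f d * indicator d t) ≈ f t
  boxSum-indicator {m} {N} f t t<N = begin
    boxSum N (λ d → f d * indicator d t)
      ≈⟨ listSum-⊆-≈ ([] ∷ []) (box-unique N m) (λ { (here ≡.refl) → sum<⇒∈box t t<N })
           (λ d d∉[t] → trans (*-congˡ (indicator-≢ d t (d∉[t] ∘ here))) (zeroʳ (f d))) ⟨
    f t * indicator t t + 0#
      ≈⟨ trans (+-identityʳ _) (trans (*-congˡ (indicator-refl t)) (*-identityʳ (f t))) ⟩
    f t ∎

  -- At the first level the move leaves the vector as it is, but has probability 0 / 1. Either
  -- alternative makes the continuing term in `endsWithin-vanishes` zero.
  moved-total : ∀ (d : State m) i → continue i ≈ 0# ⊎ Vec.sum (d +e[ i -1]) ≡ suc (Vec.sum d)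
  moved-total d zero    = inj₁ (zeroˡ _)
  moved-total d (suc j) = inj₂ (sum-updateAt-suc d j)

  -- A transition lowers the total by at most one: moves with positive
  -- probability never lower it, and ending lowers it by at most one.
  endsWithin-vanishes : ∀ k (d : State m) i t → suc (Vec.sum t) ℕ.< Vec.sum d → endsWithin k d i t ≈ 0#
  endsWithin-vanishes zero    d i t t<d = refl
  endsWithin-vanishes {m} (suc k) d i t t<d = go (view i)
    where
    branch-vanishes : ∀ i {d′} → step d i ≡ branch (d′ +e[ i -1]) d′ → Vec.sum t ℕ.< Vec.sum d′ →
      endsWithin (suc k) d i t ≈ 0#
    branch-vanishes i {d′} eq t<d′ = begin
      endsWithin (suc k) d i t
        ≡⟨ endsWithin-branch k d i t eq ⟩
      continue i * endsWithin k (d′ +e[ i -1]) i t + end i * indicator d′ t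
        ≈⟨ +-cong continue-vanishes
             (trans (*-congˡ (indicator-≢ d′ t λ d′≡t → ℕ.<⇒≢ t<d′ (≡.sym (≡.cong Vec.sum d′≡t)))) (zeroʳ _)) ⟩
      0# + 0#
        ≈⟨ +-identityˡ 0# ⟩
      0# ∎
      where
      continue-vanishes : continue i * endsWithin k (d′ +e[ i -1]) i t ≈ 0#
      continue-vanishes with moved-total d′ i
      ... | inj₁ ≈0  = trans (*-congʳ ≈0) (zeroˡ _)
      ... | inj₂ eq′ = trans (*-congˡ (endsWithin-vanishes k _ i t
              (≡.subst (suc (Vec.sum t) ℕ.<_) (≡.sym eq′) (ℕ.s≤s t<d′)))) (zeroʳ _)

    go : ∀ {i} → View i → endsWithin (suc k) d i t ≈ 0#
    go ‵fromℕ = branch-vanishes (fromℕ m) (step-last d) (ℕ.<-trans (ℕ.n<1+n _) t<d)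
    go (‵inject₁ j) with lookup d j in eq
    ... | zero  = trans (reflexive (endsWithin-advance k d (inject₁ j) t (step-empty d j eq)))
                        (endsWithin-vanishes k d (suc j) t t<d)
    ... | suc l = branch-vanishes (inject₁ j) (step-nonempty d j eq) (ℕ.s<s⁻¹
                    (≡.subst (suc (Vec.sum t) ℕ.<_) total t<d))
      where
      total : Vec.sum d ≡ suc (Vec.sum (d [ j ]≔ l))
      total = ≡.trans (≡.cong Vec.sum (≡.sym (updateAt-suc-pred d j eq))) (sum-updateAt-suc (d [ j ]≔ l) j)

  -- Eventual values of the finite-step probabilities.

  SettlesAt : State m → Fin (suc m) → State m → Carrier → Set ℓ₁
  SettlesAt d i t x = ∃[ K ] ∀ k → K ℕ.≤ k → endsWithin k d i t ≈ x

  -- Both values are attained at a common late step. This is how the one-step equations of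
  -- `endsWithin` become equations for `exit`.
  SettlesAt-unique : ∀ {d : State m} {i t x y} → SettlesAt d i t x → SettlesAt d i t y → x ≈ y
  SettlesAt-unique (K , x) (L , y) = trans (sym (x (K ℕ.⊔ L) (ℕ.m≤m⊔n K L))) (y (K ℕ.⊔ L) (ℕ.m≤n⊔m K L))

  SettlesAt-advance : ∀ {d : State m} {i i′ t x} → step d i ≡ advance i′ →
    SettlesAt d i′ t x → SettlesAt d i t x
  SettlesAt-advance {d = d} {i} {t = t} eq (K , x) = suc K , λ { (suc k) (ℕ.s≤s K≤k) →
    trans (reflexive (endsWithin-advance k d i t eq)) (x k K≤k) }

  SettlesAt-branch : ∀ {d : State m} {i t moved ended x} → step d i ≡ branch moved ended →
    SettlesAt moved i t x → SettlesAt d i t (continue i * x + end i * indicator ended t)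
  SettlesAt-branch {d = d} {i} {t} eq (K , x) = suc K , λ { (suc k) (ℕ.s≤s K≤k) →
    trans (reflexive (endsWithin-branch k d i t eq)) (+-congʳ (*-congˡ (x k K≤k))) }

  -- In the last level every move increases the total, so only finitely many
  -- moves can precede an end in t.
  settles-last : ∀ f (d : State m) t → suc (Vec.sum t) ℕ.< f ℕ.+ Vec.sum d → ∃[ x ] SettlesAt d (fromℕ m) t x
  settles-last zero    d t t<d = 0# , 0 , λ k _ → endsWithin-vanishes k d _ t t<d
  -- Without gaps a move does not raise the total, but its probability is zero, so the value is
  -- final after one step.
  settles-last {zero}  (suc f) d t _ = continue {1} zero * 0# + end {1} zero * indicator d t , 1 , λ { (suc k) _ →
    +-congʳ (trans (trans (*-congʳ continue₀≈0) (zeroˡ (endsWithin k d zero t))) (sym (zeroʳ (continue {1} zero)))) }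
    where
    continue₀≈0 : continue {1} zero ≈ 0#
    continue₀≈0 = zeroˡ _
  settles-last {suc m} (suc f) d t t<f+d =
    _ , SettlesAt-branch (step-last d) (proj₂ (settles-last f (d +e[ fromℕ (suc m) -1]) t
      (≡.subst (suc (Vec.sum t) ℕ.<_)
        (≡.trans (≡.sym (ℕ.+-suc f _)) (≡.cong (f ℕ.+_) (≡.sym (sum-updateAt-suc d (fromℕ m))))) t<f+d)))

  -- A move refills the gap below, a different coordinate, or none at the first level. A round at
  -- level `inject₁ j` thus lowers gap `j` by exactly one.
  lookup-moved : ∀ (d : State m) j → lookup (d +e[ inject₁ j -1]) j ≡ lookup d j
  lookup-moved d zero    = ≡.refl
  lookup-moved d (suc j) = Vec.lookup∘updateAt′ (suc j) (inject₁ j) (λ eq →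
    ℕ.1+n≢n (≡.trans (≡.cong toℕ eq) (Fin.toℕ-inject₁ j))) d

  -- Induction on the size of gap `j`: each move takes one element from it, and once it is empty the
  -- level above takes over.
  settles-below : ∀ (j : Fin m) t → (∀ d → ∃[ x ] SettlesAt d (suc j) t x) →
    ∀ k d → lookup d j ≡ k → ∃[ x ] SettlesAt d (inject₁ j) t x
  settles-below j t above zero    d eq = _ , SettlesAt-advance (step-empty d j eq) (proj₂ (above d))
  settles-below j t above (suc k) d eq = _ , SettlesAt-branch (step-nonempty d j eq)
    (proj₂ (settles-below j t above k _ (≡.trans (lookup-moved (d [ j ]≔ k) j) (Vec.lookup∘updateAt j d))))

  settles : ∀ t i (d : State m) → ∃[ x ] SettlesAt d i t x
  settles t = >-weakInduction (λ i → ∀ d → ∃[ x ] SettlesAt d i t x)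
    -- The first argument is fuel; the total of `t` plus two exceeds the threshold whatever `d` is.
    (λ d → settles-last (suc (suc (Vec.sum t))) d t (ℕ.m≤m+n _ (Vec.sum d)))
    (λ j above d → settles-below j t above (lookup d j) d ≡.refl)

  abstract
    -- The limiting probability of ending in `t`, kept opaque: only `exit-settles` matters from here
    -- on, and the recursions behind it stay out of the goals.
    exit : State m → Fin (suc m) → State m → Carrier
    exit d i t = proj₁ (settles t i d)

    exit-settles : ∀ (d : State m) i t → SettlesAt d i t (exit d i t)
    exit-settles d i t = proj₂ (settles t i d)

  exit-vanishes : ∀ (d : State m) i t → suc (suc (Vec.sum t)) ℕ.≤ Vec.sum d → exit d i t ≈ 0#
  exit-vanishes d i t t<d = SettlesAt-unique (exit-settles d i t) (0 , λ k _ → endsWithin-vanishes k d i t t<d)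

  exit-empty : ∀ (d : State m) j t → lookup d j ≡ 0 → exit d (inject₁ j) t ≈ exit d (suc j) t
  exit-empty d j t eq = SettlesAt-unique (exit-settles d _ t)
    (SettlesAt-advance (step-empty d j eq) (exit-settles d (suc j) t))

  -- Starting from `updateAt d j suc` makes `d` the state after the removal, which fits the second
  -- sum of `boxSum-split`.
  exit-nonempty : ∀ (d : State m) j t → exit (updateAt d j suc) (inject₁ j) t ≈
    continue (inject₁ j) * exit (d +e[ inject₁ j -1]) (inject₁ j) t + end (inject₁ j) * indicator d t
  exit-nonempty d j t = SettlesAt-unique (exit-settles _ _ t)
    (SettlesAt-branch
      (≡.trans (step-nonempty (updateAt d j suc) j (Vec.lookup∘updateAt j d))
        (≡.cong (λ d′ → branch (d′ +e[ inject₁ j -1]) d′) (updateAt-pred-suc d j)))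
      (exit-settles (d +e[ inject₁ j -1]) _ t))

  exit-last : ∀ (d : State m) t → exit d (fromℕ m) t ≈
    continue (fromℕ m) * exit (d +e[ fromℕ m -1]) (fromℕ m) t + end (fromℕ m) * indicator d t
  exit-last d t = SettlesAt-unique (exit-settles d _ t)
    (SettlesAt-branch (step-last d) (exit-settles _ _ t))

  transition : (Fin (suc m) → Carrier) → State m → State m → Carrier
  transition σ s t = sum λ i → σ i * exit s i t

  sum-settles : ∀ {n} (f : ℕ → Fin n → Carrier) (g : Fin n → Carrier) →
    (∀ i → ∃[ K ] ∀ k → K ℕ.≤ k → f k i ≈ g i) → ∃[ K ] ∀ k → K ℕ.≤ k → sum (f k) ≈ sum g
  sum-settles {zero}  f g h = 0 , λ _ _ → refl
  sum-settles {suc n} f g h =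
    let K , f₀≈g₀ = h zero
        L , ∑f≈∑g = sum-settles (λ k → f k ∘ suc) (g ∘ suc) (h ∘ suc)
    in K ℕ.⊔ L , λ k le → +-cong (f₀≈g₀ k (ℕ.m⊔n≤o⇒m≤o K L le)) (∑f≈∑g k (ℕ.m⊔n≤o⇒n≤o K L le))

  transition-isTransitionProbability : ∀ (σ : Fin (suc m) → Carrier) →
    IsTransitionProbability σ (transition σ)
  transition-isTransitionProbability σ s t ε 0<ε =
    let K , settled = sum-settles (λ k i → σ i * endsWithin k s i t) (λ i → σ i * exit s i t)
          (λ i → let L , h = exit-settles s i t in L , λ k L≤k → *-congˡ (h k L≤k))
    in K , λ k K≤k → ≈⇒Within 0<ε (sym (settled k K≤k))

  -- Cumulative probabilities and product weights.

  cdf-zero : ∀ {n} (σ : Fin (suc n) → Carrier) → cdf σ zero ≈ σ zero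
  cdf-zero {n} σ = trans (+-congˡ (sum-replicate-zero n)) (+-identityʳ (σ zero))

  cdf-∷ : ∀ {n} (σ : Fin (suc n) → Carrier) i → cdf σ (suc i) ≈ σ zero + cdf (σ ∘ suc) i
  cdf-∷ {n} σ i = +-congˡ (sum-cong-≋ {n} same)
    where
    same : ∀ j → (if does (suc j Fin.≤? suc i) then σ (suc j) else 0#)
               ≈ (if does (j Fin.≤? i) then σ (suc j) else 0#)
    -- The two comparisons compute to the same Boolean only once `j` is a constructor.
    same zero    = refl
    same (suc j) = refl

  cdf-suc : ∀ {n} (σ : Fin (suc n) → Carrier) j → cdf σ (suc j) ≈ cdf σ (inject₁ j) + σ (suc j)
  cdf-suc σ zero    = trans (cdf-∷ σ zero) (+-cong (sym (cdf-zero σ)) (cdf-zero (σ ∘ suc)))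
  cdf-suc σ (suc j) = begin
    cdf σ (suc (suc j))                                            ≈⟨ cdf-∷ σ (suc j) ⟩
    σ zero + cdf (σ ∘ suc) (suc j)                                 ≈⟨ +-congˡ (cdf-suc (σ ∘ suc) j) ⟩
    σ zero + (cdf (σ ∘ suc) (inject₁ j) + σ (suc (suc j)))         ≈⟨ +-assoc _ _ _ ⟨
    σ zero + cdf (σ ∘ suc) (inject₁ j) + σ (suc (suc j))           ≈⟨ +-congʳ (cdf-∷ σ (inject₁ j)) ⟨
    cdf σ (inject₁ (suc j)) + σ (suc (suc j))                      ∎

  cdf-last : ∀ {n} (σ : Fin (suc n) → Carrier) → cdf σ (fromℕ n) ≈ sum σ
  cdf-last {zero}  σ = refl
  cdf-last {suc n} σ = trans (cdf-∷ σ (fromℕ n)) (+-congˡ (cdf-last (σ ∘ suc)))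

  ⨂-updateAt-suc : ∀ (μ : Fin m → ℕ → Carrier) q d j → (∀ k → μ j (suc k) ≈ q * μ j k) →
    ⨂ μ (updateAt d j suc) ≈ q * ⨂ μ d
  ⨂-updateAt-suc μ q (k ∷ d) zero    μ-suc = trans (*-congʳ (μ-suc k)) (*-assoc q _ _)
  ⨂-updateAt-suc μ q (k ∷ d) (suc j) μ-suc = trans (*-congˡ (⨂-updateAt-suc (μ ∘ suc) q d j μ-suc))
    (solve 3 (λ a q b → a :* (q :* b) := q :* (a :* b)) refl (μ zero k) q _)

-- Total mass and invariance of the product law.

module Stationarity {c ℓ₁ ℓ₂} (F : ArchimedeanOrderedField c ℓ₁ ℓ₂) where

  open ArchimedeanOrderedField F hiding (zero) renaming (fromℕ to natural)
  open Process F
  open OrderedField F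
  open ListSum F
  open Transition F
  open import Algebra.Properties.Semiring.Exp semiring using (_^_)
  open import Algebra.Properties.Semiring.Sum semiring using (sum; sum-cong-≋; *-distribˡ-sum; sum-replicate-zero)
  open import Algebra.Solver.Ring.NaturalCoefficients.Default commutativeSemiring using (solve; _:+_; _:*_; _:=_; con)
  open ≈-Reasoning setoid

  -- Lists are compared with boxes: a list containing a box of mass above 1 - ε inherits that mass,
  -- and every list lies in some box, whose mass is at most one.
  geometric-isDistribution : ∀ {m} (p q : Fin m → Carrier) → (∀ i → q i + p i ≈ 1#) →
    (∀ i → 0# < q i) → (∀ i → 0# < p i) → IsDistribution (⨂ λ i k → q i ^ k * p i)
  geometric-isDistribution {m} p q q+p≈1 0<q 0<p = record
    { nonNegative = 0≤π
    ; totalMass   = λ ε 0<ε →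
        let N , small = sum-vanishes (λ i n → q i ^ n) (λ i → ^-vanishes (q+p≈1 i) (0<q i) (0<p i)) ε 0<ε
        in box N m , λ L L! box⊆L →
             x<y+z⇒x-z<y (≤-<-trans (proj₂ (mass N))
               (<-≤-trans (+-monoʳ-< (boxSum N π) (small N ℕ.≤-refl))
                 (+-monoˡ-≤ ε (listSum-⊆-≤ (box-unique N m) L! box⊆L 0≤π))))
           , ≤-<-trans (≤-trans (listSum-⊆-≤ L! (box-unique (bound L) m) (⊆box L) 0≤π) (proj₁ (mass (bound L))))
               (x<x+y 0<ε)
    }
    where
    π : State m → Carrier
    π = ⨂ λ i k → q i ^ k * p i

    0≤π : ∀ d → 0# ≤ π d
    0≤π d = <⇒≤ (product-pos _ λ i → *-pos (^-pos (0<q i) (lookup d i)) (0<p i))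

    mass : ∀ N → boxSum N π ≤ 1# × 1# ≤ boxSum N π + sum (λ i → q i ^ N)
    mass N =
      let series = λ i → listSum (λ k → q i ^ k * p i) (upTo N)
          0≤series = λ i → listSum-nonNegative (upTo N) (λ k → <⇒≤ (*-pos (^-pos (0<q i) k) (0<p i)))
          _ , ≤1 , 1≤ = product-complements (λ i → q i ^ N) series (λ i → geometric-series (q+p≈1 i) N)
            (λ i → <⇒≤ (^-pos (0<q i) N)) 0≤series
          eq = sym (boxSum-⨂ N (λ i k → q i ^ k * p i))
      in ≤-respˡ-≈ eq ≤1 , ≤-respʳ-≈ (+-congʳ eq) 1≤

    bound : List (State m) → ℕ
    bound []      = 0
    bound (d ∷ L) = suc (Vec.sum d) ℕ.⊔ bound L

    <bound : ∀ {d} L → d ∈ L → Vec.sum d ℕ.< bound L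
    <bound (d ∷ L) (here ≡.refl) = ℕ.m≤m⊔n (suc (Vec.sum d)) (bound L)
    <bound (d ∷ L) (there d∈L)   = ℕ.≤-trans (<bound L d∈L) (ℕ.m≤n⊔m (suc (Vec.sum d)) (bound L))

    ⊆box : ∀ L → L ⊆ box (bound L) m
    ⊆box L {d} d∈L = sum<⇒∈box d (<bound L d∈L)

  -- The flow through level i, weighted by the probability of finally ending in
  -- t, is cdf σ i * weight i; it splits into what passes to level i + 1, what
  -- moves on within level i, and what ends in t, namely π t / n.
  module Invariance {m} (σ : Fin (suc m) → Carrier) (∑σ≈1 : sum σ ≈ 1#)
    (π : State m → Carrier) (q : Fin m → Carrier)
    (π-updateAt : ∀ d j → π (updateAt d j suc) ≈ q j * π d)
    (w : Carrier) (n*w≈1 : natural (suc m) * w ≈ 1#)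
    (cdf*q : ∀ j → cdf σ (inject₁ j) * q j ≈ natural (suc (toℕ j)) * w)
    (t : State m) (N : ℕ) (t+2≤N : suc (suc (Vec.sum t)) ℕ.≤ N) where

    v = w * π t

    weight shifted : Fin (suc m) → Carrier
    weight  i = boxSum N λ d → π d * exit d i t
    shifted i = boxSum N λ d → π d * exit (d +e[ i -1]) i t

    -- Flow rising from level `inject₁ j` through an empty gap `j`, weighted by the exit probability
    -- of the upper level so that `outflow` and `inflow` share this term.
    passed : Fin m → Carrier
    passed j = boxSum N λ d → δ₀ (lookup d j) * (cdf σ (inject₁ j) * (π d * exit d (suc j) t))

    -- Since σ_{≤ i} q_i = i / n and a move has probability (i - 1) / i, moves within level i carry
    -- the factor (i - 1) / n, which is `natural (toℕ i) * w`.
    moved : Fin (suc m) → Carrier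
    moved i = natural (toℕ i) * w * shifted i

    -- The level `i` is independent of `j` because gap `j` is split both at level `inject₁ j` and at
    -- level `suc j`. A state with `N ≤ lookup d j` has total at least that of `t` plus two, where
    -- `exit` vanishes.
    exit-split : ∀ a i j → a * weight i ≈
      boxSum N (λ d → δ₀ (lookup d j) * (a * (π d * exit d i t)))
      + boxSum N (λ d → a * (π (updateAt d j suc) * exit (updateAt d j suc) i t))
    exit-split a i j = trans (sym (listSum-*ˡ a _ (box N m)))
      (boxSum-split N j (λ d → a * (π d * exit d i t)) λ d N≤dⱼ →
        trans (*-congˡ (trans (*-congˡ (exit-vanishes d i t (ℕ.≤-trans t+2≤N (ℕ.≤-trans N≤dⱼ (lookup≤sum d j))))) (zeroʳ _))) (zeroʳ a))

    -- The factor 1 / i for ending turns i / n into 1 / n, hence the same term `v` at every level.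
    -- The parameters `a` and `f` cover the inner levels, where an element is removed, and the last
    -- one, where `f` is `π` itself.
    leave : ∀ i a (f : State m → Carrier) → (∀ d → a * f d ≈ natural (suc (toℕ i)) * w * π d) →
      boxSum N (λ d → a * (f d * (continue i * exit (d +e[ i -1]) i t + end i * indicator d t)))
      ≈ moved i + v
    leave i a f af≈ = begin
      boxSum N (λ d → a * (f d * (continue i * exit (d +e[ i -1]) i t + end i * indicator d t)))
        ≈⟨ listSum-cong (box N m) pointwise ⟩
      boxSum N (λ d → k * w * (π d * exit (d +e[ i -1]) i t) + w * (π d * indicator d t))
        ≈⟨ listSum-+ _ _ (box N m) ⟩
      boxSum N (λ d → k * w * (π d * exit (d +e[ i -1]) i t)) + boxSum N (λ d → w * (π d * indicator d t))
        ≈⟨ +-cong (listSum-*ˡ (k * w) _ (box N m)) (listSum-*ˡ w _ (box N m)) ⟩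
      moved i + w * boxSum N (λ d → π d * indicator d t)
        ≈⟨ +-congˡ (*-congˡ (boxSum-indicator π t (ℕ.<-trans (ℕ.n<1+n _) t+2≤N))) ⟩
      moved i + v ∎
      where
      k = natural (toℕ i)
      r = recip (natural (suc (toℕ i))) (0<fromℕ-suc (toℕ i))
      pointwise : ∀ d → a * (f d * (continue i * exit (d +e[ i -1]) i t + end i * indicator d t))
                ≈ k * w * (π d * exit (d +e[ i -1]) i t) + w * (π d * indicator d t)
      pointwise d = begin
        a * (f d * (k * r * x + natural 1 * r * y))
          ≈⟨ solve 6 (λ a f k r x y → a :* (f :* (k :* r :* x :+ (con 1 :+ con 0) :* r :* y))
                                    := a :* f :* (r :* (k :* x :+ y))) refl a (f d) k r x y ⟩
        a * f d * (r * (k * x + y))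
          ≈⟨ *-congʳ (af≈ d) ⟩
        natural (suc (toℕ i)) * w * π d * (r * (k * x + y))
          ≈⟨ solve 7 (λ n w p r k x y → n :* w :* p :* (r :* (k :* x :+ y))
                                      := n :* r :* (k :* w :* (p :* x) :+ w :* (p :* y))) refl _ w (π d) r k x y ⟩
        natural (suc (toℕ i)) * r * (k * w * (π d * x) + w * (π d * y))
          ≈⟨ trans (*-congʳ (*-recip _ _)) (*-identityˡ _) ⟩
        k * w * (π d * x) + w * (π d * y) ∎
        where
        x = exit (d +e[ i -1]) i t
        y = indicator d t

    outflow : ∀ j → cdf σ (inject₁ j) * weight (inject₁ j) ≈ passed j + (moved (inject₁ j) + v)
    outflow j = trans (exit-split a (inject₁ j) j) (+-cong
      (listSum-cong (box N m) same)
      (trans (listSum-cong (box N m) λ d → *-congˡ (*-congˡ (exit-nonempty d j t)))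
        (leave (inject₁ j) a (λ d → π (updateAt d j suc)) af≈)))
      where
      a = cdf σ (inject₁ j)
      same : ∀ d → δ₀ (lookup d j) * (a * (π d * exit d (inject₁ j) t))
                 ≈ δ₀ (lookup d j) * (a * (π d * exit d (suc j) t))
      same d with lookup d j in eq
      ... | zero  = *-congˡ (*-congˡ (*-congˡ (exit-empty d j t eq)))
      ... | suc _ = trans (zeroˡ _) (sym (zeroˡ _))
      af≈ : ∀ d → a * π (updateAt d j suc) ≈ natural (suc (toℕ (inject₁ j))) * w * π d
      af≈ d = begin
        a * π (updateAt d j suc)                      ≈⟨ *-congˡ (π-updateAt d j) ⟩
        a * (q j * π d)                               ≈⟨ *-assoc a (q j) (π d) ⟨
        a * q j * π d                                 ≈⟨ *-congʳ (cdf*q j) ⟩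
        natural (suc (toℕ j)) * w * π d               ≡⟨ ≡.cong (λ k → natural (suc k) * w * π d) (Fin.toℕ-inject₁ j) ⟨
        natural (suc (toℕ (inject₁ j))) * w * π d     ∎

    -- The last level has no gap that could be empty, so nothing passes further; the coefficient
    -- `1#` is σ_{≤ n}.
    outflow-last : weight (fromℕ m) ≈ moved (fromℕ m) + v
    outflow-last = trans (listSum-cong (box N m) λ d → trans (*-congˡ (exit-last d t)) (sym (*-identityˡ _)))
      (leave (fromℕ m) 1# π λ d → *-congʳ (begin
        1#                                      ≈⟨ n*w≈1 ⟨
        natural (suc m) * w                     ≡⟨ ≡.cong (λ k → natural (suc k) * w) (Fin.toℕ-fromℕ m) ⟨
        natural (suc (toℕ (fromℕ m))) * w       ∎))

    -- These are the visits to level `suc j` not due to sampling that level. With gap `j` empty they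
    -- come from the level below; otherwise from a move within the level, since that move adds an
    -- element to gap `j`.
    inflow : ∀ j → cdf σ (inject₁ j) * weight (suc j) ≈ passed j + moved (suc j)
    inflow j = trans (exit-split a (suc j) j) (+-congˡ
      (trans (listSum-cong (box N m) pointwise) (listSum-*ˡ (natural (suc (toℕ j)) * w) _ (box N m))))
      where
      a = cdf σ (inject₁ j)
      pointwise : ∀ d → a * (π (updateAt d j suc) * exit (updateAt d j suc) (suc j) t)
                ≈ natural (suc (toℕ j)) * w * (π d * exit (updateAt d j suc) (suc j) t)
      pointwise d = begin
        a * (π (updateAt d j suc) * x)  ≈⟨ *-congˡ (*-congʳ (π-updateAt d j)) ⟩
        a * (q j * π d * x)             ≈⟨ solve 4 (λ a q p x → a :* (q :* p :* x) := a :* q :* (p :* x)) refl a (q j) (π d) x ⟩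
        a * q j * (π d * x)             ≈⟨ *-congʳ (cdf*q j) ⟩
        natural (suc (toℕ j)) * w * (π d * x) ∎
        where x = exit (updateAt d j suc) (suc j) t

    -- What rises above level `i`. Unlike `passed`, the difference is defined at the last level too,
    -- where it vanishes, as `telescope` requires.
    flow : Fin (suc m) → Carrier
    flow i = cdf σ i * weight i - (moved i + v)

    flow-inject₁ : ∀ j → flow (inject₁ j) ≈ passed j
    flow-inject₁ j = sym (x+y≈z⇒x≈z-y (sym (outflow j)))

    flow-last : flow (fromℕ m) ≈ 0#
    flow-last = sym (x+y≈z⇒x≈z-y (begin
      0# + (moved (fromℕ m) + v)           ≈⟨ +-identityˡ _ ⟩
      moved (fromℕ m) + v                  ≈⟨ outflow-last ⟨
      weight (fromℕ m)                     ≈⟨ *-identityˡ _ ⟨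
      1# * weight (fromℕ m)                ≈⟨ *-congʳ (trans (cdf-last σ) ∑σ≈1) ⟨
      cdf σ (fromℕ m) * weight (fromℕ m)   ∎))

    balance-zero : σ zero * weight zero + 0# ≈ flow zero + v
    balance-zero = begin
      σ zero * weight zero + 0#          ≈⟨ +-identityʳ _ ⟩
      σ zero * weight zero               ≈⟨ *-congʳ (cdf-zero σ) ⟨
      cdf σ zero * weight zero           ≈⟨ x-y+y≈x _ (moved zero + v) ⟨
      -- `moved zero` has the factor `natural 0`: the first level has no moves.
      flow zero + (moved zero + v)       ≈⟨ +-congˡ (+-congʳ (trans (*-congʳ (zeroˡ w)) (zeroˡ _))) ⟩
      flow zero + (0# + v)               ≈⟨ +-congˡ (+-identityˡ v) ⟩
      flow zero + v                      ∎

    -- The moves within level `suc j` enter and leave it in equal measure, so `moved (suc j)`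
    -- cancels between inflow and outflow.
    balance-suc : ∀ j → σ (suc j) * weight (suc j) + flow (inject₁ j) ≈ flow (suc j) + v
    balance-suc j = begin
      σᵢ * weight i + flow (inject₁ j)    ≈⟨ +-congˡ (flow-inject₁ j) ⟩
      σᵢ * weight i + passed j            ≈⟨ x+y≈z⇒x≈z-y total ⟩
      flow i + v + moved i - moved i      ≈⟨ x+y≈z⇒x≈z-y refl ⟨
      flow i + v                          ∎
      where
      i  = suc j
      σᵢ = σ i
      total : σᵢ * weight i + passed j + moved i ≈ flow i + v + moved i
      total = begin
        σᵢ * weight i + passed j + moved i
          ≈⟨ +-assoc _ _ _ ⟩
        σᵢ * weight i + (passed j + moved i)
          ≈⟨ +-congˡ (inflow j) ⟨
        σᵢ * weight i + cdf σ (inject₁ j) * weight i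
          ≈⟨ solve 3 (λ s x a → s :* x :+ a :* x := (a :+ s) :* x) refl σᵢ (weight i) _ ⟩
        (cdf σ (inject₁ j) + σᵢ) * weight i
          ≈⟨ *-congʳ (cdf-suc σ j) ⟨
        cdf σ i * weight i
          ≈⟨ x-y+y≈x _ (moved i + v) ⟨
        flow i + (moved i + v)
          ≈⟨ solve 3 (λ f x v → f :+ (x :+ v) := f :+ v :+ x) refl (flow i) (moved i) v ⟩
        flow i + v + moved i ∎

    total-weight : sum (λ i → σ i * weight i) ≈ π t
    total-weight = begin
      sum (λ i → σ i * weight i)                     ≈⟨ +-identityʳ _ ⟨
      sum (λ i → σ i * weight i) + 0#                ≈⟨ telescope (λ i → σ i * weight i) flow balance-zero balance-suc ⟩
      flow (fromℕ m) + natural (suc m) * (w * π t)   ≈⟨ +-cong flow-last (sym (*-assoc _ w (π t))) ⟩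
      0# + natural (suc m) * w * π t                 ≈⟨ +-identityˡ _ ⟩
      natural (suc m) * w * π t                      ≈⟨ *-congʳ n*w≈1 ⟩
      1# * π t                                       ≈⟨ *-identityˡ _ ⟩
      π t                                            ∎

    invariant : HasSum (λ s → π s * transition σ s t) (π t)
    invariant = finite-HasSum (box-unique N m)
      -- A state outside the box has total at least `N`, too large to reach `t` by removing at most
      -- one element.
      (λ s s∉box → trans (*-congˡ (transition-vanishes s (ℕ.≮⇒≥ (s∉box ∘ sum<⇒∈box s)))) (zeroʳ (π s)))
      (begin
        boxSum N (λ s → π s * transition σ s t)
          ≈⟨ listSum-cong (box N m) expand ⟩
        boxSum N (λ s → sum (λ i → σ i * (π s * exit s i t)))
          ≈⟨ listSum-sum (λ s i → σ i * (π s * exit s i t)) (box N m) ⟩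
        sum (λ i → boxSum N (λ s → σ i * (π s * exit s i t)))
          ≈⟨ sum-cong-≋ {suc m} (λ i → listSum-*ˡ (σ i) (λ s → π s * exit s i t) (box N m)) ⟩
        sum (λ i → σ i * weight i)
          ≈⟨ total-weight ⟩
        π t ∎)
      where
      transition-vanishes : ∀ s → N ℕ.≤ Vec.sum s → transition σ s t ≈ 0#
      transition-vanishes s N≤s = trans
        (sum-cong-≋ {suc m} (λ i → trans (*-congˡ (exit-vanishes s i t (ℕ.≤-trans t+2≤N N≤s))) (zeroʳ (σ i))))
        (sum-replicate-zero (suc m))
      expand : ∀ s → π s * transition σ s t ≈ sum (λ i → σ i * (π s * exit s i t))
      expand s = trans (*-distribˡ-sum {suc m} (π s) (λ i → σ i * exit s i t))
        (sum-cong-≋ {suc m} (λ i → solve 3 (λ p s x → p :* (s :* x) := s :* (p :* x)) refl (π s) (σ i) (exit s i t)))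

  stationary : ∀ m (σ : Fin (suc m) → Carrier) → IsFinDistribution σ →
    (i/n<σ≤i : ∀ (i : Fin m) → suc (toℕ i) /ℕ suc m < cdf σ (inject₁ i)) →
    ∃[ P ] (IsTransitionProbability σ P × IsStationary P (geometricProduct σ i/n<σ≤i))
  stationary m σ σ-dist i/n<σ≤i =
    transition σ , transition-isTransitionProbability σ , record
      { isDistribution = geometric-isDistribution p q q+p≈1 0<q 0<p
      ; invariant      = λ t → Invariance.invariant σ (IsFinDistribution.totalMass σ-dist) _ q
          (λ d j → ⨂-updateAt-suc (λ i k → q i ^ k * p i) (q j) d j (λ k → *-assoc (q j) (q j ^ k) (p j)))
          -- Unification with `ℕ.≤-refl` fixes the side of the box as the total of `t` plus two.
          w (*-recip _ _) cdf*q t _ ℕ.≤-refl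
      }
    where
    n = natural (suc m)
    w = recip n (0<fromℕ-suc m)
    κ b b⁻¹ x p q : Fin m → Carrier
    κ i = natural (suc (toℕ i))
    b i = n * cdf σ (inject₁ i)
    0<b : ∀ i → 0# < b i
    0<b i = /ℕ<⇒0<* (toℕ i) m (i/n<σ≤i i)
    b⁻¹ i = recip (b i) (0<b i)
    x i = κ i * b⁻¹ i
    p i = 1# - x i
    -- Written through `p i` rather than as `x i`, to agree definitionally with `Geom`.
    q i = 1# - p i

    q+p≈1 : ∀ i → q i + p i ≈ 1#
    q+p≈1 i = x-y+y≈x 1# (p i)

    q≈x : ∀ i → q i ≈ x i
    q≈x i = sym (x+y≈z⇒x≈z-y (trans (+-comm (x i) (p i)) (x-y+y≈x 1# (x i))))

    0<q : ∀ i → 0# < q i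
    0<q i = <-respʳ-≈ (sym (q≈x i)) (*-pos (0<fromℕ-suc (toℕ i)) (recip-pos (b i) (0<b i)))

    κ<b : ∀ i → κ i < b i
    κ<b i = <-respˡ-≈ (begin
      n * (κ i * w) ≈⟨ solve 3 (λ n k w → n :* (k :* w) := k :* (n :* w)) refl n (κ i) w ⟩
      κ i * (n * w) ≈⟨ *-congˡ (*-recip n _) ⟩
      κ i * 1#      ≈⟨ *-identityʳ _ ⟩
      κ i           ∎) (*-monoˡ-< n (0<fromℕ-suc m) (i/n<σ≤i i))

    0<p : ∀ i → 0# < p i
    0<p i = 0<x-y (<-respˡ-≈ (*-comm _ _) (<-respʳ-≈ (trans (*-comm _ _) (*-recip (b i) (0<b i)))
      (*-monoˡ-< (b⁻¹ i) (recip-pos (b i) (0<b i)) (κ<b i))))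

    cdf*q : ∀ j → cdf σ (inject₁ j) * q j ≈ κ j * w
    cdf*q j = begin
      a * q j                     ≈⟨ *-congˡ (q≈x j) ⟩
      a * (κ j * b⁻¹ j)           ≈⟨ *-identityˡ _ ⟨
      1# * (a * (κ j * b⁻¹ j))    ≈⟨ *-congʳ (*-recip n (0<fromℕ-suc m)) ⟨
      n * w * (a * (κ j * b⁻¹ j)) ≈⟨ solve 5 (λ n w a k i → n :* w :* (a :* (k :* i)) := k :* w :* (n :* a :* i)) refl n w a (κ j) (b⁻¹ j) ⟩
      κ j * w * (b j * b⁻¹ j)     ≈⟨ *-congˡ (*-recip (b j) (0<b j)) ⟩
      κ j * w * 1#                ≈⟨ *-identityʳ _ ⟩
      κ j * w                     ∎
      where a = cdf σ (inject₁ j)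

open import Defs

theorem5 : (m : ℕ) (σ : Fin (suc m) → ℝ) → IsFinDistribution σ →
    (i/n<σ≤i : (i : Fin m) → suc (toℕ i) /ℕ suc m <ℝ cdf σ (inject₁ i)) →
    ∃[ P ] (IsTransitionProbability σ P × IsStationary P (geometricProduct σ i/n<σ≤i))
theorem5 = Stationarity.stationary ℝ-field
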